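{- For all $r,n\in\mathbb{Z}_{>0}$, $$\sum_{a\in\{1,\ldots,n\}^r}q^{\mathrm{imaj}(w_a)}=\sum_{\ell=1}^nS(r,\ell)\,[n][n-1]\cdots[n-\ell+1].$$
   Context: $q$ is an indeterminate, $[i]=\frac{q^i-1}{q-1}=q^{i-1}+\cdots+q+1$ for integers $i\ge0$, and $S(r,\ell)$ is the number of set partitions of an $r$-element set into $\ell$ nonempty subsets. For $a=(a_1,\ldots,a_r)\in\{1,\ldots,n\}^r$, $w_a\in S_n$ (in one-line notation) is the permutation obtained from the sequence $(1,2,\ldots,n,a_1,\ldots,a_r)$ by keeping only the rightmost occurrence of each integer in $\{1,\ldots,n\}$. For example, for $n=6$ and $a=(2,1,3,1,6,4,6,3,4)$, $w_a=(5,2,1,6,3,4)$. For $w=(w_1,\ldots,w_n)\in S_n$, the set of backsteps is $\mathrm{BS}(w)=\{i\in\{1,\ldots,n-1\}\mid i+1\text{ is to the left of }i\text{ in }(w_1,\ldots,w_n)\}$, and $\mathrm{imaj}(w)=\sum_{i\in\mathrm{BS}(w)}i$. -}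

module Defs where

open import Data.Fin as Fin using (Fin; zero; suc; toℕ; inject₁)
open import Data.Fin.Permutation using (Permutation; Permutation′; permutation; _⟨$⟩ˡ_; _∘ₚ_; cast-id; ↔⇒≡)
open import Data.Fin.Subset as Subset using (Subset; inside; outside; _∩_; ⋃; Nonempty; Empty)
open import Data.Fin.Subset.Properties using (nonempty?)
import Data.Bool.Properties as Bool
import Data.Fin.Properties as Fin
open import Data.Integer as ℤ using (ℤ; 0ℤ; 1ℤ)
open import Data.List using (List; []; _∷_; _++_; map; foldr; filter; length; lookup; allFin; upTo; cartesianProductWith)
open import Data.List.Membership.DecPropositional using (_∈?_)
open import Data.List.Membership.Propositional using (_∈_)
open import Data.List.Membership.Propositional.Properties using (∈-allFin; ∈-++⁺ˡ; ∈-lookup)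
import Data.List.Relation.Unary.All as All
import Data.List.Relation.Unary.AllPairs as AllPairs
open import Data.List.Relation.Unary.All using (All)
open import Data.List.Relation.Unary.AllPairs using (AllPairs)
open import Data.List.Relation.Unary.Any as Any using (here; there)
open import Data.List.Relation.Unary.Any.Properties using (lookup-index)
open import Data.List.Relation.Unary.Unique.Propositional using (Unique; []; _∷_)
open import Data.Nat using (ℕ; zero; suc; _∸_)
import Data.Nat.ListAction as ℕ
open import Data.Product using (_×_)
open import Data.Vec as Vec using (Vec)
import Data.Vec.Properties as Vec
open import Function using (_∘_)
open import Relation.Binary.PropositionalEquality using (_≡_; refl; sym; cong)
open import Relation.Nullary using (yes; no; ¬?; contradiction)
open import Relation.Nullary.Decidable using (_×-dec_)
open import Relation.Unary using (Decidable)

-- c₀ ∷ c₁ ∷ … ∷ [] is c₀ + c₁ q + ⋯.  Trailing zeros are allowed, so the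
-- equality of ℤ[q] is _≈ₚ_ and not _≡_.
Poly : Set
Poly = List ℤ

coeff : Poly → ℕ → ℤ
coeff []      _       = 0ℤ
coeff (c ∷ _) zero    = c
coeff (_ ∷ p) (suc k) = coeff p k

infix 4 _≈ₚ_

_≈ₚ_ : Poly → Poly → Set
p ≈ₚ p′ = ∀ k → coeff p k ≡ coeff p′ k

infixl 6 _+ₚ_
infixl 7 _*ₚ_

_+ₚ_ : Poly → Poly → Poly
[]      +ₚ p′        = p′
(c ∷ p) +ₚ []        = c ∷ p
(c ∷ p) +ₚ (c′ ∷ p′) = (c ℤ.+ c′) ∷ (p +ₚ p′)

_*ₚ_ : Poly → Poly → Poly
[]      *ₚ p′ = []
(c ∷ p) *ₚ p′ = map (c ℤ.*_) p′ +ₚ (0ℤ ∷ (p *ₚ p′))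

natₚ : ℕ → Poly
natₚ n = (ℤ.+ n) ∷ []

q^_ : ℕ → Poly
q^ zero  = 1ℤ ∷ []
q^ suc k = 0ℤ ∷ (q^ k)

∑ₚ ∏ₚ : List Poly → Poly
∑ₚ = foldr _+ₚ_ (natₚ 0)
∏ₚ = foldr _*ₚ_ (natₚ 1)

-- [ i ]q = 1 + q + ⋯ + q^(i-1), the quotient (q^i - 1)/(q - 1).
[_]q : ℕ → Poly
[ i ]q = ∑ₚ (map q^_ (upTo i))

-- [n][n-1]⋯[n-ℓ+1].  The truncated subtraction is exact for ℓ ≤ n.
fallingₚ : ℕ → ℕ → Poly
fallingₚ n ℓ = ∏ₚ (map (λ j → [ n ∸ j ]q) (upTo ℓ))

vectors : ∀ {A : Set} → List A → (r : ℕ) → List (Vec A r)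
vectors xs zero    = Vec.[] ∷ []
vectors xs (suc r) = cartesianProductWith Vec._∷_ xs (vectors xs r)

-- The set {1,…,n}^r, each word listed once; the letter i + 1 is encoded
-- by the element i of Fin n.
words : (n r : ℕ) → List (Vec (Fin n) r)
words n r = vectors (allFin n) r

subsets : (r : ℕ) → List (Subset r)
subsets r = vectors (outside ∷ inside ∷ []) r

sublists : ∀ {A : Set} → ℕ → List A → List (List A)
sublists zero    _        = [] ∷ []
sublists (suc ℓ) []       = []
sublists (suc ℓ) (x ∷ xs) = map (x ∷_) (sublists ℓ xs) ++ sublists (suc ℓ) xs

Disjoint : ∀ {r} → Subset r → Subset r → Set
Disjoint A B = Empty (A ∩ B)

IsSetPartition : ∀ {r} → List (Subset r) → Set
IsSetPartition F = All Nonempty F × AllPairs Disjoint F × ⋃ F ≡ Subset.⊤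

isSetPartition? : ∀ {r} → Decidable (IsSetPartition {r})
isSetPartition? F =
  All.all? nonempty? F
    ×-dec AllPairs.allPairs? (λ A B → ¬? (nonempty? (A ∩ B))) F
    ×-dec Vec.≡-dec Bool._≟_ (⋃ F) Subset.⊤

-- subsets r has no repetitions, so its sublists of length ℓ are exactly the
-- sets of ℓ subsets of Fin r, each occurring once.
setPartitions : (r ℓ : ℕ) → List (List (Subset r))
setPartitions r ℓ = filter isSetPartition? (sublists ℓ (subsets r))

S : ℕ → ℕ → ℕ
S r ℓ = length (setPartitions r ℓ)

keepRightmost : ∀ {n} → List (Fin n) → List (Fin n)
keepRightmost []       = []
keepRightmost (x ∷ xs) with _∈?_ Fin._≟_ x xs
... | yes _ = keepRightmost xs
... | no  _ = x ∷ keepRightmost xs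

keepRightmost-∈⁺ : ∀ {n} {x : Fin n} xs → x ∈ xs → x ∈ keepRightmost xs
keepRightmost-∈⁺ (y ∷ xs) x∈ with _∈?_ Fin._≟_ y xs | x∈
... | yes y∈xs | here refl  = keepRightmost-∈⁺ xs y∈xs
... | yes _    | there x∈xs = keepRightmost-∈⁺ xs x∈xs
... | no  _    | here refl  = here refl
... | no  _    | there x∈xs = there (keepRightmost-∈⁺ xs x∈xs)

keepRightmost-∈⁻ : ∀ {n} {x : Fin n} xs → x ∈ keepRightmost xs → x ∈ xs
keepRightmost-∈⁻ (y ∷ xs) x∈ with _∈?_ Fin._≟_ y xs | x∈
... | yes _ | x∈xs       = there (keepRightmost-∈⁻ xs x∈xs)
... | no  _ | here refl  = here refl
... | no  _ | there x∈xs = there (keepRightmost-∈⁻ xs x∈xs)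

keepRightmost-unique : ∀ {n} (xs : List (Fin n)) → Unique (keepRightmost xs)
keepRightmost-unique []       = []
keepRightmost-unique (x ∷ xs) with _∈?_ Fin._≟_ x xs
... | yes _   = keepRightmost-unique xs
... | no x∉xs =
  All.tabulate (λ { y∈ refl → x∉xs (keepRightmost-∈⁻ xs y∈) })
    ∷ keepRightmost-unique xs

lookup-injective : ∀ {A : Set} {xs : List A} → Unique xs →
                   ∀ i j → lookup xs i ≡ lookup xs j → i ≡ j
lookup-injective (x∉ ∷ u) zero    zero    _  = refl
lookup-injective {xs = _ ∷ xs} (x∉ ∷ u) zero (suc j) eq =
  contradiction eq (All.lookup x∉ (∈-lookup j))
lookup-injective {xs = _ ∷ xs} (x∉ ∷ u) (suc i) zero eq =
  contradiction (sym eq) (All.lookup x∉ (∈-lookup i))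
lookup-injective (x∉ ∷ u) (suc i) (suc j) eq =
  cong suc (lookup-injective u i j eq)

-- The one-line notation of w a.
oneLine : ∀ {n r} → Vec (Fin n) r → List (Fin n)
oneLine {n} a = keepRightmost (allFin n ++ Vec.toList a)

oneLine-complete : ∀ {n r} (a : Vec (Fin n) r) (i : Fin n) → i ∈ oneLine a
oneLine-complete {n} a i = keepRightmost-∈⁺ (allFin n ++ Vec.toList a) (∈-++⁺ˡ (∈-allFin i))

lookup↔ : ∀ {n} (xs : List (Fin n)) → Unique xs → (∀ i → i ∈ xs) →
          Permutation (length xs) n
lookup↔ xs u complete = permutation
  (lookup xs)
  (λ i → Any.index (complete i))
  (λ i → sym (lookup-index (complete i)))
  (λ k → lookup-injective u _ _ (sym (lookup-index (complete (lookup xs k)))))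

-- w a ⟨$⟩ʳ k is the entry at position k of the one-line notation, and
-- w a ⟨$⟩ˡ i is the position of the letter i in it.
w : ∀ {n r} → Vec (Fin n) r → Permutation′ n
w {n} a = cast-id (sym (↔⇒≡ π)) ∘ₚ π
  where
  π : Permutation (length (oneLine a)) n
  π = lookup↔ (oneLine a) (keepRightmost-unique (allFin n ++ Vec.toList a)) (oneLine-complete a)

-- In Fin (suc m), inject₁ i and suc i encode the consecutive letters
-- toℕ i + 1 and toℕ i + 2.
IsBackstep : ∀ {m} → Permutation′ (suc m) → Fin m → Set
IsBackstep v i = (v ⟨$⟩ˡ suc i) Fin.< (v ⟨$⟩ˡ inject₁ i)

isBackstep? : ∀ {m} (v : Permutation′ (suc m)) → Decidable (IsBackstep v)
isBackstep? v i = (v ⟨$⟩ˡ suc i) Fin.<? (v ⟨$⟩ˡ inject₁ i)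

BS : ∀ {n} → Permutation′ n → List ℕ
BS {zero}  v = []
BS {suc m} v = map (suc ∘ toℕ) (filter (isBackstep? v) (allFin m))

imaj : ∀ {n} → Permutation′ n → ℕ
imaj v = ℕ.sum (BS v)

{-# OPTIONS --safe #-}
module Submission where

-- A polynomial is determined by the functionals Σ cₖ qᵏ ↦ Σ cₖ h(k), so both
-- sides are compared after applying such a functional, for all h at once.
-- Both satisfy a recursion that lowers n by one.  On the left, fix the last
-- letter j of a word of length r + 1: deleting the other occurrences of j
-- leaves a word a′ of some length k over n - 1 letters, each arising C(r,k)
-- times, and w_a is w_a′ with j inserted at the end.  In terms of the inverse
-- permutation this inserts a new maximum at position j, and by Carlitz's
-- insertion argument the n choices of j raise the major index by
-- 0, 1, …, n - 1 in some order, which produces the factor [n].  On the right,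
-- use S(r+1,ℓ+1) = Σₖ C(r,k) S(k,ℓ).

import Algebra.Properties.Semiring.Sum
import Data.Bool.Properties as Bool
open import Data.Fin using (Fin; zero; suc; toℕ; inject₁; fromℕ; punchIn; punchOut; _≟_)
open import Data.Fin.Permutation using (Permutation′; _⟨$⟩ˡ_)
open import Data.Fin.Properties
  using (suc-injective; punchIn-injective; punchInᵢ≢i; punchIn-punchOut; punchOut-punchIn; punchOut-cong; toℕ-inject₁; toℕ-fromℕ; toℕ-cast)
open import Data.Fin.Subset using (Subset; inside; outside; ⋃; Nonempty; ∣_∣; _∩_; _∪_; _⊆_; _─_; ⊤)
  renaming (_∈_ to _∈ˢ_; _∉_ to _∉ˢ_)
open import Data.Fin.Subset.Properties
  using (nonempty?; _⊆?_; ∉⊥; ∣⊤∣≡n; drop-∷-⊆; out⊆; in⊆in; ⊆-antisym; ⊆-reflexive; ∪-identityˡ; ∪-identityʳ; ∪-assoc; x∈p∩q⁺; x∈p∩q⁻; x∈p∪q⁺; x∈p∪q⁻; q⊆p∪q; p─q⊆p; x∈p∧x∉q⇒x∈p─q)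
  renaming (_∈?_ to _∈ˢ?_)
open import Data.Integer using (ℤ; 0ℤ; 1ℤ; _+_; _*_) renaming (+_ to pos)
open import Data.Integer.Properties
  using (+-*-semiring; +-comm; +-assoc; +-identityˡ; +-identityʳ; *-assoc; *-identityˡ; *-identityʳ; *-zeroˡ; *-zeroʳ; *-distribˡ-+; *-distribʳ-+)
import Data.Integer.Tactic.RingSolver as ℤ
open import Data.List
  using (List; []; _∷_; _++_; map; filter; length; allFin; tabulate; upTo; applyUpTo; cartesianProductWith)
open import Data.List.Membership.DecPropositional using (_∈?_)
open import Data.List.Membership.Propositional using (_∈_; _∉_)
open import Data.List.Membership.Propositional.Properties using (∈-++⁺ˡ; ∈-++⁺ʳ; ∈-++⁻; ∈-allFin)
open import Data.List.Properties using (++-assoc; ++-identityʳ; map-applyUpTo; map-tabulate)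
open import Data.List.Relation.Unary.All as All using (All; []; _∷_)
import Data.List.Relation.Unary.All.Properties as All
open import Data.List.Relation.Unary.AllPairs using (AllPairs; []; _∷_; allPairs?)
open import Data.List.Relation.Unary.Any as Any using (Any; here; there)
import Data.List.Relation.Unary.Any.Properties as Any
open import Data.List.Relation.Unary.Unique.Propositional using (Unique)
import Data.List.Relation.Unary.Unique.Propositional.Properties as Unique
open import Data.Nat as ℕ using (ℕ; zero; suc; NonZero; _<_; _<?_; z≤n; s≤s)
import Data.Nat.ListAction as ℕ
import Data.Nat.Properties as ℕ
import Data.Nat.Tactic.RingSolver as ℕ
open import Data.Product using (_×_; _,_)
open import Data.Sum using (inj₁; inj₂; [_,_]′)
open import Data.Vec as Vec using (Vec; []; _∷_; here; there)
import Data.Vec.Properties as Vec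
open import Defs
open import Function using (_∘_; id; case_of_)
open import Relation.Binary.PropositionalEquality
open import Relation.Nullary using (Dec; yes; no; ¬_; ¬?; contradiction)
open import Relation.Nullary.Decidable using (_×-dec_)
open import Relation.Unary using (Decidable)

open Algebra.Properties.Semiring.Sum +-*-semiring
  using (sum; sum-syntax; sum-cong-≗; sum-remove; ∑-distrib-+; ∑-comm; sum-init-last; sum-replicate-zero)
module ℕΣ = Algebra.Properties.Semiring.Sum ℕ.+-*-semiring
open ≡-Reasoning

private variable
  A B C P Q : Set
  n r       : ℕ

-- Integer sums over lists.

+-interchange : ∀ a b c d → (a + b) + (c + d) ≡ (a + c) + (b + d)
+-interchange = ℤ.solve-∀

∑ᴸ : (A → ℤ) → List A → ℤ
∑ᴸ f []       = 0ℤ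
∑ᴸ f (x ∷ xs) = f x + ∑ᴸ f xs

∑ᴸ-cong : {f g : A → ℤ} → f ≗ g → ∑ᴸ f ≗ ∑ᴸ g
∑ᴸ-cong f≗g []       = refl
∑ᴸ-cong f≗g (x ∷ xs) = cong₂ _+_ (f≗g x) (∑ᴸ-cong f≗g xs)

∑ᴸ-++ : ∀ (f : A → ℤ) xs ys → ∑ᴸ f (xs ++ ys) ≡ ∑ᴸ f xs + ∑ᴸ f ys
∑ᴸ-++ f []       ys = sym (+-identityˡ _)
∑ᴸ-++ f (x ∷ xs) ys = trans (cong (f x +_) (∑ᴸ-++ f xs ys)) (sym (+-assoc (f x) _ _))

∑ᴸ-map : ∀ (f : B → ℤ) (g : A → B) xs → ∑ᴸ f (map g xs) ≡ ∑ᴸ (f ∘ g) xs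
∑ᴸ-map f g []       = refl
∑ᴸ-map f g (x ∷ xs) = cong (f (g x) +_) (∑ᴸ-map f g xs)

∑ᴸ-zero : {f : A → ℤ} → (∀ x → f x ≡ 0ℤ) → ∀ xs → ∑ᴸ f xs ≡ 0ℤ
∑ᴸ-zero f≡0 []       = refl
∑ᴸ-zero f≡0 (x ∷ xs) = cong₂ _+_ (f≡0 x) (∑ᴸ-zero f≡0 xs)

∑ᴸ-+ : ∀ (f g : A → ℤ) xs → ∑ᴸ (λ x → f x + g x) xs ≡ ∑ᴸ f xs + ∑ᴸ g xs
∑ᴸ-+ f g []       = refl
∑ᴸ-+ f g (x ∷ xs) = trans (cong (f x + g x +_) (∑ᴸ-+ f g xs)) (+-interchange (f x) _ _ _)

∑ᴸ-comm : ∀ (f : A → B → ℤ) xs ys →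
          ∑ᴸ (λ x → ∑ᴸ (f x) ys) xs ≡ ∑ᴸ (λ y → ∑ᴸ (λ x → f x y) xs) ys
∑ᴸ-comm f []       ys = sym (∑ᴸ-zero (λ _ → refl) ys)
∑ᴸ-comm f (x ∷ xs) ys =
  trans (cong (∑ᴸ (f x) ys +_) (∑ᴸ-comm f xs ys)) (sym (∑ᴸ-+ (f x) _ ys))

∑ᴸ-*ˡ : ∀ c (f : A → ℤ) xs → ∑ᴸ (λ x → c * f x) xs ≡ c * ∑ᴸ f xs
∑ᴸ-*ˡ c f []       = sym (*-zeroʳ c)
∑ᴸ-*ˡ c f (x ∷ xs) =
  trans (cong (c * f x +_) (∑ᴸ-*ˡ c f xs)) (sym (*-distribˡ-+ c (f x) _))

∑ᴸ-cartesianProductWith : ∀ (f : C → ℤ) (g : A → B → C) xs ys →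
  ∑ᴸ f (cartesianProductWith g xs ys) ≡ ∑ᴸ (λ x → ∑ᴸ (f ∘ g x) ys) xs
∑ᴸ-cartesianProductWith f g []       ys = refl
∑ᴸ-cartesianProductWith f g (x ∷ xs) ys =
  trans (∑ᴸ-++ f (map (g x) ys) _)
        (cong₂ _+_ (∑ᴸ-map f (g x) ys) (∑ᴸ-cartesianProductWith f g xs ys))

∑ᴸ-tabulate : ∀ (f : A → ℤ) {n} (g : Fin n → A) → ∑ᴸ f (tabulate g) ≡ sum (f ∘ g)
∑ᴸ-tabulate f {zero}  g = refl
∑ᴸ-tabulate f {suc n} g = cong (f (g zero) +_) (∑ᴸ-tabulate f (g ∘ suc))

∑ᴸ-applyUpTo : ∀ (f : A → ℤ) (g : ℕ → A) n → ∑ᴸ f (applyUpTo g n) ≡ ∑[ i < n ] f (g (toℕ i))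
∑ᴸ-applyUpTo f g zero    = refl
∑ᴸ-applyUpTo f g (suc n) = cong (f (g 0) +_) (∑ᴸ-applyUpTo f (g ∘ suc) n)

-- Polynomials under linear functionals.

eval : (ℕ → ℤ) → Poly → ℤ
eval h []      = 0ℤ
eval h (c ∷ p) = c * h 0 + eval (h ∘ suc) p

eval-zero : ∀ p → eval (λ _ → 0ℤ) p ≡ 0ℤ
eval-zero []      = refl
eval-zero (c ∷ p) = cong₂ _+_ (*-zeroʳ c) (eval-zero p)

eval-+ : ∀ (g h : ℕ → ℤ) p → eval (λ i → g i + h i) p ≡ eval g p + eval h p
eval-+ g h []      = refl
eval-+ g h (c ∷ p) =
  trans (cong₂ _+_ (*-distribˡ-+ c (g 0) (h 0)) (eval-+ (g ∘ suc) (h ∘ suc) p))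
        (+-interchange (c * g 0) _ _ _)

eval-sum : ∀ {n} (h : Fin n → ℕ → ℤ) p →
           eval (λ k → ∑[ i < n ] h i k) p ≡ ∑[ i < n ] eval (h i) p
eval-sum {zero}  h p = eval-zero p
eval-sum {suc n} h p =
  trans (eval-+ (h zero) _ p) (cong (eval (h zero) p +_) (eval-sum (h ∘ suc) p))

eval-+ₚ : ∀ h p p′ → eval h (p +ₚ p′) ≡ eval h p + eval h p′
eval-+ₚ h []      p′        = sym (+-identityˡ _)
eval-+ₚ h (c ∷ p) []        = sym (+-identityʳ _)
eval-+ₚ h (c ∷ p) (c′ ∷ p′) =
  trans (cong₂ _+_ (*-distribʳ-+ (h 0) c c′) (eval-+ₚ (h ∘ suc) p p′))
        (+-interchange (c * h 0) _ _ _)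

eval-scale : ∀ h c p → eval h (map (c *_) p) ≡ c * eval h p
eval-scale h c []      = sym (*-zeroʳ c)
eval-scale h c (d ∷ p) =
  trans (cong₂ _+_ (*-assoc c d (h 0)) (eval-scale (h ∘ suc) c p))
        (sym (*-distribˡ-+ c _ _))

-- Since qⁱqʲ = qⁱ⁺ʲ, bilinearity turns a product of polynomials into one functional applied inside
-- another, and no convolution of coefficients has to be handled.
eval-*ₚ : ∀ h p p′ → eval h (p *ₚ p′) ≡ eval (λ i → eval (λ j → h (i ℕ.+ j)) p′) p
eval-*ₚ h []      p′ = refl
eval-*ₚ h (c ∷ p) p′ =
  trans (eval-+ₚ h (map (c *_) p′) _)
        (cong₂ _+_ (eval-scale h c p′) (trans (+-identityˡ _) (eval-*ₚ (h ∘ suc) p p′)))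

eval-natₚ-*ₚ : ∀ h m p → eval h (natₚ m *ₚ p) ≡ pos m * eval h p
eval-natₚ-*ₚ h m p = trans (eval-*ₚ h (natₚ m) p) (+-identityʳ _)

eval-q^ : ∀ h k → eval h (q^ k) ≡ h k
eval-q^ h zero    = trans (+-identityʳ _) (*-identityˡ (h 0))
eval-q^ h (suc k) = trans (+-identityˡ _) (eval-q^ (h ∘ suc) k)

eval-∑ₚ : ∀ h (f : A → Poly) xs → eval h (∑ₚ (map f xs)) ≡ ∑ᴸ (eval h ∘ f) xs
eval-∑ₚ h f []       = refl
eval-∑ₚ h f (x ∷ xs) =
  trans (eval-+ₚ h (f x) _) (cong (eval h (f x) +_) (eval-∑ₚ h f xs))

eval-[]q : ∀ h n → eval h [ n ]q ≡ ∑[ i < n ] h (toℕ i)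
eval-[]q h n = begin
  eval h [ n ]q                     ≡⟨ eval-∑ₚ h q^_ (upTo n) ⟩
  ∑ᴸ (eval h ∘ q^_) (upTo n)        ≡⟨ ∑ᴸ-cong (eval-q^ h) (upTo n) ⟩
  ∑ᴸ h (upTo n)                     ≡⟨ ∑ᴸ-applyUpTo h id n ⟩
  ∑[ i < n ] h (toℕ i)              ∎

-- The adjoint of multiplication by `[ n ]q`: applying `eval (window n h)` to `p` amounts to
-- applying `eval h` to `[ n ]q *ₚ p`.
window : ℕ → (ℕ → ℤ) → ℕ → ℤ
window n h k = ∑[ i < n ] h (toℕ i ℕ.+ k)

eval-fallingₚ-suc : ∀ h n ℓ →
  eval h (fallingₚ (suc n) (suc ℓ)) ≡ eval (window (suc n) h) (fallingₚ n ℓ)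
eval-fallingₚ-suc h n ℓ = begin
  eval h (fallingₚ (suc n) (suc ℓ))
    -- Only the leading factor is split off: `suc n ∸ suc j` computes to `n ∸ j`, so the remaining
    -- factors are those of `fallingₚ n ℓ`.
    ≡⟨ cong (λ ps → eval h ([ suc n ]q *ₚ ∏ₚ ps))
         (trans (map-applyUpTo suc (λ j → [ suc n ℕ.∸ j ]q) ℓ)
                (sym (map-applyUpTo id (λ j → [ n ℕ.∸ j ]q) ℓ))) ⟩
  eval h ([ suc n ]q *ₚ fallingₚ n ℓ)
    ≡⟨ eval-*ₚ h [ suc n ]q (fallingₚ n ℓ) ⟩
  eval (λ i → eval (λ k → h (i ℕ.+ k)) (fallingₚ n ℓ)) [ suc n ]q
    ≡⟨ eval-[]q (λ i → eval (λ k → h (i ℕ.+ k)) (fallingₚ n ℓ)) (suc n) ⟩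
  ∑[ i < suc n ] eval (λ k → h (toℕ i ℕ.+ k)) (fallingₚ n ℓ)
    ≡⟨ eval-sum {suc n} (λ i k → h (toℕ i ℕ.+ k)) (fallingₚ n ℓ) ⟨
  eval (window (suc n) h) (fallingₚ n ℓ) ∎

δ : ℕ → ℕ → ℤ
δ zero    zero    = 1ℤ
δ zero    (suc j) = 0ℤ
δ (suc k) zero    = 0ℤ
δ (suc k) (suc j) = δ k j

coeff≡eval-δ : ∀ p k → coeff p k ≡ eval (δ k) p
coeff≡eval-δ []      k       = refl
coeff≡eval-δ (c ∷ p) zero    =
  sym (trans (cong₂ _+_ (*-identityʳ c) (eval-zero p)) (+-identityʳ c))
coeff≡eval-δ (c ∷ p) (suc k) =
  trans (coeff≡eval-δ p k)
        (sym (trans (cong (_+ eval (δ k) p) (*-zeroʳ c)) (+-identityˡ _)))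

-- The Kronecker deltas `δ k` are among the functionals, and they read off the coefficients.
eval⇒≈ₚ : ∀ {p p′} → (∀ h → eval h p ≡ eval h p′) → p ≈ₚ p′
eval⇒≈ₚ {p} {p′} eq k =
  trans (coeff≡eval-δ p k) (trans (eq (δ k)) (sym (coeff≡eval-δ p′ k)))

-- Binomial sums and Stirling numbers.

-- Σₖ C(r,k) f(k), by Pascal's rule.
binomialSum : (ℕ → ℤ) → ℕ → ℤ
binomialSum f zero    = f 0
binomialSum f (suc r) = binomialSum f r + binomialSum (f ∘ suc) r

binomialSum-cong : ∀ {f g : ℕ → ℤ} → f ≗ g → binomialSum f ≗ binomialSum g
binomialSum-cong f≗g zero    = f≗g 0
binomialSum-cong f≗g (suc r) =
  cong₂ _+_ (binomialSum-cong f≗g r) (binomialSum-cong (f≗g ∘ suc) r)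

binomialSum-*ʳ : ∀ f c r → binomialSum f r * c ≡ binomialSum (λ k → f k * c) r
binomialSum-*ʳ f c zero    = refl
binomialSum-*ʳ f c (suc r) =
  trans (*-distribʳ-+ c (binomialSum f r) _)
        (cong₂ _+_ (binomialSum-*ʳ f c r) (binomialSum-*ʳ (f ∘ suc) c r))

sum-binomialSum : ∀ {n} (f : Fin n → ℕ → ℤ) r →
  ∑[ i < n ] binomialSum (f i) r ≡ binomialSum (λ k → ∑[ i < n ] f i k) r
sum-binomialSum f zero    = refl
sum-binomialSum f (suc r) =
  trans (∑-distrib-+ (λ i → binomialSum (f i) r) _)
        (cong₂ _+_ (sum-binomialSum f r) (sum-binomialSum (λ i → f i ∘ suc) r))

-- stirling ℓ r is S(r,ℓ): the arguments are swapped.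
stirling : ℕ → ℕ → ℤ
stirling zero    zero    = 1ℤ
stirling zero    (suc r) = 0ℤ
stirling (suc ℓ) zero    = 0ℤ
stirling (suc ℓ) (suc r) = binomialSum (stirling ℓ) r

-- Indicators of decidable properties.

χ : Dec P → ℤ
χ (yes _) = 1ℤ
χ (no _)  = 0ℤ

χ-cong : (P → Q) → (Q → P) → (P? : Dec P) (Q? : Dec Q) → χ P? ≡ χ Q?
χ-cong f g (yes p) (yes q) = refl
χ-cong f g (yes p) (no ¬q) = contradiction (f p) ¬q
χ-cong f g (no ¬p) (yes q) = contradiction (g q) ¬p
χ-cong f g (no ¬p) (no ¬q) = refl

χ-no : ¬ P → (P? : Dec P) → χ P? ≡ 0ℤ
χ-no ¬p (yes p) = contradiction p ¬p
χ-no ¬p (no _)  = refl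

χ-× : (P? : Dec P) (Q? : Dec Q) → χ (P? ×-dec Q?) ≡ χ P? * χ Q?
χ-× (yes p) (yes q) = refl
χ-× (yes p) (no ¬q) = refl
χ-× (no ¬p) q?      = refl

length-filter≡∑χ : ∀ {P : A → Set} (P? : Decidable P) xs → pos (length (filter P? xs)) ≡ ∑ᴸ (χ ∘ P?) xs
length-filter≡∑χ P? []       = refl
length-filter≡∑χ P? (x ∷ xs) with P? x
... | yes _ = cong (1ℤ +_) (length-filter≡∑χ P? xs)
... | no  _ = trans (length-filter≡∑χ P? xs) (sym (+-identityˡ _))

-- Set partitions and the block of the first element.

-- The ground set `T` is variable for the sake of induction: removing one block leaves a partition
-- of a smaller ground set inside the same `Subset r`. `IsSetPartition` is the case `T = ⊤`.
IsPartitionOf : ∀ {r} → Subset r → List (Subset r) → Set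
IsPartitionOf T F = All Nonempty F × AllPairs Disjoint F × ⋃ F ≡ T

isPartitionOf? : ∀ {r} (T : Subset r) → Decidable (IsPartitionOf T)
isPartitionOf? T F =
  All.all? nonempty? F
    ×-dec allPairs? (λ A B → ¬? (nonempty? (A ∩ B))) F
    ×-dec Vec.≡-dec Bool._≟_ (⋃ F) T

∈-⋃⁺ : ∀ {r} {x : Fin r} {F} → Any (x ∈ˢ_) F → x ∈ˢ ⋃ F
∈-⋃⁺ (here x∈A)  = x∈p∪q⁺ (inj₁ x∈A)
∈-⋃⁺ (there x∈F) = x∈p∪q⁺ (inj₂ (∈-⋃⁺ x∈F))

∈-⋃⁻ : ∀ {r} {x : Fin r} F → x ∈ˢ ⋃ F → Any (x ∈ˢ_) F
∈-⋃⁻ []      x∈ = contradiction x∈ ∉⊥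
∈-⋃⁻ (A ∷ F) x∈ = [ here , there ∘ ∈-⋃⁻ F ]′ (x∈p∪q⁻ A (⋃ F) x∈)

x∈p─q⇒x∉q : ∀ {r} {x : Fin r} p q → x ∈ˢ p ─ q → x ∉ˢ q
x∈p─q⇒x∉q (_ ∷ p) (inside ∷ q)  () here
x∈p─q⇒x∉q (_ ∷ p) (_ ∷ q)       (there x∈) (there x∈q) = x∈p─q⇒x∉q p q x∈ x∈q

p∪q─q≡p : ∀ {r} (p q : Subset r) → Disjoint p q → (p ∪ q) ─ q ≡ p
p∪q─q≡p p q p#q = ⊆-antisym
  (λ x∈ → [ id , (λ x∈q → contradiction x∈q (x∈p─q⇒x∉q (p ∪ q) q x∈)) ]′
            (x∈p∪q⁻ p q (p─q⊆p (p ∪ q) q x∈)))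
  (λ x∈p → x∈p∧x∉q⇒x∈p─q (x∈p∪q⁺ (inj₁ x∈p)) (λ x∈q → p#q (_ , x∈p∩q⁺ (x∈p , x∈q))))

p─q∪q≡p : ∀ {r} (p q : Subset r) → q ⊆ p → (p ─ q) ∪ q ≡ p
p─q∪q≡p p q q⊆p = ⊆-antisym
  (λ x∈ → [ p─q⊆p p q , q⊆p ]′ (x∈p∪q⁻ (p ─ q) q x∈))
  (λ {x} x∈p → x∈p∪q⁺ (case x x∈p))
  where
  case : ∀ x → x ∈ˢ p → _
  case x x∈p with x ∈ˢ? q
  ... | yes x∈q = inj₂ x∈q
  ... | no  x∉q = inj₁ (x∈p∧x∉q⇒x∈p─q x∈p x∉q)

⋃-map-outside : ∀ {r} (G : List (Subset r)) → ⋃ (map (outside ∷_) G) ≡ outside ∷ ⋃ G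
⋃-map-outside []      = refl
⋃-map-outside (A ∷ G) = cong ((outside ∷ A) ∪_) (⋃-map-outside G)

⋃-map-outside-∷ʳ-inside : ∀ {r} (G : List (Subset r)) B →
  ⋃ (map (outside ∷_) G ++ (inside ∷ B) ∷ []) ≡ inside ∷ (⋃ G ∪ B)
⋃-map-outside-∷ʳ-inside []      B =
  cong (inside ∷_) (trans (∪-identityʳ B) (sym (∪-identityˡ B)))
⋃-map-outside-∷ʳ-inside (A ∷ G) B = begin
  (outside ∷ A) ∪ ⋃ (map (outside ∷_) G ++ (inside ∷ B) ∷ [])
    ≡⟨ cong ((outside ∷ A) ∪_) (⋃-map-outside-∷ʳ-inside G B) ⟩
  inside ∷ (A ∪ (⋃ G ∪ B))
    ≡⟨ cong (inside ∷_) (∪-assoc A (⋃ G) B) ⟨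
  inside ∷ ((A ∪ ⋃ G) ∪ B) ∎

nonempty-outside⁺ : ∀ {r} {A : Subset r} → Nonempty A → Nonempty (outside ∷ A)
nonempty-outside⁺ (i , i∈A) = suc i , there i∈A

nonempty-outside⁻ : ∀ {r} {A : Subset r} → Nonempty (outside ∷ A) → Nonempty A
nonempty-outside⁻ (suc i , there i∈A) = i , i∈A

disjoint-outside⁺ : ∀ {r s} {A B : Subset r} → Disjoint A B → Disjoint (outside ∷ A) (s ∷ B)
disjoint-outside⁺ A#B = A#B ∘ nonempty-outside⁻

disjoint-∷⁻ : ∀ {r s t} {A B : Subset r} → Disjoint (s ∷ A) (t ∷ B) → Disjoint A B
disjoint-∷⁻ sA#tB (i , i∈) = sA#tB (suc i , there i∈)

disjoint-map-outside⁺ : ∀ {r} {G : List (Subset r)} →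
  AllPairs Disjoint G → AllPairs Disjoint (map (outside ∷_) G)
disjoint-map-outside⁺ []          = []
disjoint-map-outside⁺ (A#G ∷ G#) = All.map⁺ (All.map (disjoint-outside⁺ {s = outside}) A#G) ∷ disjoint-map-outside⁺ G#

disjoint-map-outside⁻ : ∀ {r} (G : List (Subset r)) {H} →
  AllPairs Disjoint (map (outside ∷_) G ++ H) → AllPairs Disjoint G
disjoint-map-outside⁻ []      _          = []
disjoint-map-outside⁻ (A ∷ G) (A# ∷ G#) =
  All.map (disjoint-∷⁻ {s = outside} {outside}) (All.map⁻ (All.++⁻ˡ _ A#)) ∷ disjoint-map-outside⁻ G G#

allPairs-++⁻ʳ : ∀ {R : A → A → Set} xs {ys} → AllPairs R (xs ++ ys) → AllPairs R ys
allPairs-++⁻ʳ []       ps       = ps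
allPairs-++⁻ʳ (x ∷ xs) (_ ∷ ps) = allPairs-++⁻ʳ xs ps

allPairs-∷ʳ⁺ : ∀ {R : A → A → Set} {xs y} → AllPairs R xs → All (λ x → R x y) xs → AllPairs R (xs ++ y ∷ [])
allPairs-∷ʳ⁺ []        []        = [] ∷ []
allPairs-∷ʳ⁺ (p ∷ ps) (q ∷ qs) = All.++⁺ p (q ∷ []) ∷ allPairs-∷ʳ⁺ ps qs

allPairs-∷ʳ⁻ : ∀ {R : A → A → Set} xs {y} → AllPairs R (xs ++ y ∷ []) → All (λ x → R x y) xs
allPairs-∷ʳ⁻ []       _        = []
allPairs-∷ʳ⁻ (x ∷ xs) (p ∷ ps) = All.head (All.++⁻ʳ xs p) ∷ allPairs-∷ʳ⁻ xs ps

partition-outside⁺ : ∀ {r} {T : Subset r} {G} →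
  IsPartitionOf T G → IsPartitionOf (outside ∷ T) (map (outside ∷_) G)
partition-outside⁺ {G = G} (ne , G# , ⋃G≡T) =
  All.map⁺ (All.map nonempty-outside⁺ ne) , disjoint-map-outside⁺ G# ,
  trans (⋃-map-outside G) (cong (outside ∷_) ⋃G≡T)

partition-outside⁻ : ∀ {r} {T : Subset r} G →
  IsPartitionOf (outside ∷ T) (map (outside ∷_) G) → IsPartitionOf T G
partition-outside⁻ G (ne , G# , eq) =
  All.map nonempty-outside⁻ (All.map⁻ ne) ,
  disjoint-map-outside⁻ G {[]} (subst (AllPairs Disjoint) (sym (++-identityʳ _)) G#) ,
  Vec.∷-injectiveʳ (trans (sym (⋃-map-outside G)) eq)

-- Here `B` is what remains of the block of `zero` once `zero` is taken out, and `G` consists of the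
-- other blocks. With the converse below, the pairs of a set `B ⊆ T` and a partition of `T ─ B`
-- account for all partitions of this shape.
partition-inside⁺ : ∀ {r} {T : Subset r} {G B} → B ⊆ T → IsPartitionOf (T ─ B) G →
  IsPartitionOf (inside ∷ T) (map (outside ∷_) G ++ (inside ∷ B) ∷ [])
partition-inside⁺ {T = T} {G} {B} B⊆T (ne , G# , eq) =
  All.++⁺ (All.map⁺ (All.map nonempty-outside⁺ ne)) ((zero , here) ∷ []) ,
  allPairs-∷ʳ⁺ (disjoint-map-outside⁺ G#) (All.map⁺ (All.tabulate (disjoint-outside⁺ {s = inside} ∘ G#B))) ,
  trans (⋃-map-outside-∷ʳ-inside G B)
        (cong (inside ∷_) (trans (cong (_∪ B) eq) (p─q∪q≡p T B B⊆T)))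
  where
  G#B : ∀ {A} → A ∈ G → Disjoint A B
  G#B {A} A∈G (x , x∈) with x∈A , x∈B ← x∈p∩q⁻ A B x∈ =
    x∈p─q⇒x∉q T B (⊆-reflexive eq (∈-⋃⁺ (Any.map (λ { refl → x∈A }) A∈G))) x∈B

partition-inside⁻ : ∀ {r} {T : Subset r} G B →
  IsPartitionOf (inside ∷ T) (map (outside ∷_) G ++ (inside ∷ B) ∷ []) →
  B ⊆ T × IsPartitionOf (T ─ B) G
partition-inside⁻ {T = T} G B (ne , G# , eq) =
  (λ x∈B → ⊆-reflexive T≡ (q⊆p∪q (⋃ G) B x∈B)) ,
  All.map nonempty-outside⁻ (All.map⁻ (All.++⁻ˡ _ ne)) ,
  disjoint-map-outside⁻ G G# ,
  sym (trans (cong (_─ B) (sym T≡)) (p∪q─q≡p (⋃ G) B ⋃G#B))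
  where
  T≡ : ⋃ G ∪ B ≡ T
  T≡ = Vec.∷-injectiveʳ (trans (sym (⋃-map-outside-∷ʳ-inside G B)) eq)
  G#B : All (λ A → Disjoint A B) G
  G#B = All.map (disjoint-∷⁻ {s = outside} {inside}) (All.map⁻ (allPairs-∷ʳ⁻ (map (outside ∷_) G) G#))
  ⋃G#B : Disjoint (⋃ G) B
  ⋃G#B (x , x∈) with x∈⋃G , x∈B ← x∈p∩q⁻ (⋃ G) B x∈ =
    let A#B , x∈A = All.lookupAny G#B (∈-⋃⁻ G x∈⋃G) in A#B (x , x∈p∩q⁺ (x∈A , x∈B))

module _ {r} (T : Subset r) where

  -- The element `zero` is covered by a block but is not in the ground set.
  ¬partition-outside : ∀ G B H → ¬ IsPartitionOf (outside ∷ T) (map (outside ∷_) G ++ (inside ∷ B) ∷ H)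
  ¬partition-outside G B H (_ , _ , eq) with () ← ⊆-reflexive eq (∈-⋃⁺ (Any.++⁺ʳ (map (outside ∷_) G) (here here)))

  ¬partition-inside₀ : ∀ G → ¬ IsPartitionOf (inside ∷ T) (map (outside ∷_) G)
  ¬partition-inside₀ G (_ , _ , eq) with () ← trans (sym (⋃-map-outside G)) eq

  -- Two blocks share the element `zero`, so they are not disjoint.
  ¬partition-inside₂ : ∀ G B G′ B′ H → ¬ IsPartitionOf (inside ∷ T)
    (map (outside ∷_) G ++ (inside ∷ B) ∷ map (outside ∷_) G′ ++ (inside ∷ B′) ∷ H)
  ¬partition-inside₂ G B G′ B′ H (_ , F# , _) with B#F ∷ _ ← allPairs-++⁻ʳ (map (outside ∷_) G) F# =
    All.head (All.++⁻ʳ (map (outside ∷_) G′) B#F) (zero , here)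

-- Sums over families of subsets.

-- subsets (suc r) lists the sets without zero first, so in a sublist the
-- blocks containing zero come last.

∑-sublists-outside : ∀ {r} (φ : List (Subset (suc r)) → ℤ) →
  (∀ G B H → φ (map (outside ∷_) G ++ (inside ∷ B) ∷ H) ≡ 0ℤ) → ∀ ℓ X Y →
  ∑ᴸ φ (sublists ℓ (map (outside ∷_) X ++ map (inside ∷_) Y)) ≡ ∑ᴸ (φ ∘ map (outside ∷_)) (sublists ℓ X)
∑-sublists-outside φ φ≡0 zero    X       Y       = refl
∑-sublists-outside φ φ≡0 (suc ℓ) []      []      = refl
∑-sublists-outside φ φ≡0 (suc ℓ) []      (B ∷ Y) = begin
  ∑ᴸ φ (map ((inside ∷ B) ∷_) F ++ sublists (suc ℓ) (map (inside ∷_) Y))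
    ≡⟨ ∑ᴸ-++ φ (map ((inside ∷ B) ∷_) F) _ ⟩
  ∑ᴸ φ (map ((inside ∷ B) ∷_) F) + ∑ᴸ φ (sublists (suc ℓ) (map (inside ∷_) Y))
    ≡⟨ cong₂ _+_ (trans (∑ᴸ-map φ _ F) (∑ᴸ-zero (φ≡0 [] B) F))
                 (∑-sublists-outside φ φ≡0 (suc ℓ) [] Y) ⟩
  0ℤ ∎
  where F = sublists ℓ (map (inside ∷_) Y)
∑-sublists-outside φ φ≡0 (suc ℓ) (A ∷ X) Y       = begin
  ∑ᴸ φ (map ((outside ∷ A) ∷_) (sublists ℓ Z) ++ sublists (suc ℓ) Z)
    ≡⟨ ∑ᴸ-++ φ (map ((outside ∷ A) ∷_) (sublists ℓ Z)) _ ⟩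
  ∑ᴸ φ (map ((outside ∷ A) ∷_) (sublists ℓ Z)) + ∑ᴸ φ (sublists (suc ℓ) Z)
    ≡⟨ cong₂ _+_
         (trans (∑ᴸ-map φ _ (sublists ℓ Z))
           (trans (∑-sublists-outside (φ ∘ ((outside ∷ A) ∷_)) (φ≡0 ∘ (A ∷_)) ℓ X Y)
             (sym (∑ᴸ-map (φ ∘ map (outside ∷_)) (A ∷_) (sublists ℓ X)))))
         (∑-sublists-outside φ φ≡0 (suc ℓ) X Y) ⟩
  ∑ᴸ φ′ (map (A ∷_) (sublists ℓ X)) + ∑ᴸ φ′ (sublists (suc ℓ) X)
    ≡⟨ ∑ᴸ-++ φ′ (map (A ∷_) (sublists ℓ X)) _ ⟨
  ∑ᴸ φ′ (sublists (suc ℓ) (A ∷ X)) ∎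
  where
  Z = map (outside ∷_) X ++ map (inside ∷_) Y
  φ′ = φ ∘ map (outside ∷_)

-- The hypotheses discard the families in which no block or at least two blocks contain `zero`, so
-- what is left is a family `G` avoiding `zero` and one further block. The summand `φ` is arbitrary
-- because the induction on `X` absorbs each chosen set into it.
∑-sublists-inside : ∀ {r} (φ : List (Subset (suc r)) → ℤ) →
  (∀ G → φ (map (outside ∷_) G) ≡ 0ℤ) →
  (∀ G B G′ B′ H → φ (map (outside ∷_) G ++ (inside ∷ B) ∷ map (outside ∷_) G′ ++ (inside ∷ B′) ∷ H) ≡ 0ℤ) → ∀ ℓ X Y →
  ∑ᴸ φ (sublists (suc ℓ) (map (outside ∷_) X ++ map (inside ∷_) Y))
    ≡ ∑ᴸ (λ G → ∑ᴸ (λ B → φ (map (outside ∷_) G ++ (inside ∷ B) ∷ [])) Y) (sublists ℓ X)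
∑-sublists-inside φ φ₀ φ₂ zero    []      []      = refl
∑-sublists-inside φ φ₀ φ₂ zero    []      (B ∷ Y) =
  trans (cong (φ ((inside ∷ B) ∷ []) +_) (∑-sublists-inside φ φ₀ φ₂ zero [] Y))
        (sym (+-assoc (φ ((inside ∷ B) ∷ [])) _ 0ℤ))
∑-sublists-inside φ φ₀ φ₂ (suc ℓ) []      []      = refl
∑-sublists-inside φ φ₀ φ₂ (suc ℓ) []      (B ∷ Y) = begin
  ∑ᴸ φ (map ((inside ∷ B) ∷_) F ++ sublists (2 ℕ.+ ℓ) (map (inside ∷_) Y))
    ≡⟨ ∑ᴸ-++ φ (map ((inside ∷ B) ∷_) F) _ ⟩
  ∑ᴸ φ (map ((inside ∷ B) ∷_) F) + ∑ᴸ φ (sublists (2 ℕ.+ ℓ) (map (inside ∷_) Y))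
    -- A set containing `zero` has been chosen, at least one more is still due, and only sets
    -- containing `zero` are left. With the first choice absorbed into `ψ`, the sum reduces to one
    -- over the sublists of length `suc ℓ` of the empty list.
    ≡⟨ cong₂ _+_ (trans (∑ᴸ-map φ _ F) (∑-sublists-outside ψ ψ≡0 (suc ℓ) [] Y))
                 (∑-sublists-inside φ φ₀ φ₂ (suc ℓ) [] Y) ⟩
  0ℤ ∎
  where
  F = sublists (suc ℓ) (map (inside ∷_) Y)
  ψ : List (Subset _) → ℤ
  ψ H = φ ((inside ∷ B) ∷ H)
  ψ≡0 : ∀ G B′ H → ψ (map (outside ∷_) G ++ (inside ∷ B′) ∷ H) ≡ 0ℤ
  ψ≡0 = φ₂ [] B
∑-sublists-inside φ φ₀ φ₂ zero    (A ∷ X) Y       =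
  trans (cong₂ _+_ (φ₀ (A ∷ [])) (∑-sublists-inside φ φ₀ φ₂ zero X Y)) (+-identityˡ _)
∑-sublists-inside φ φ₀ φ₂ (suc ℓ) (A ∷ X) Y       = begin
  ∑ᴸ φ (map ((outside ∷ A) ∷_) (sublists (suc ℓ) Z) ++ sublists (2 ℕ.+ ℓ) Z)
    ≡⟨ ∑ᴸ-++ φ (map ((outside ∷ A) ∷_) (sublists (suc ℓ) Z)) _ ⟩
  ∑ᴸ φ (map ((outside ∷ A) ∷_) (sublists (suc ℓ) Z)) + ∑ᴸ φ (sublists (2 ℕ.+ ℓ) Z)
    ≡⟨ cong₂ _+_
         (trans (∑ᴸ-map φ _ (sublists (suc ℓ) Z))
           (trans (∑-sublists-inside (φ ∘ ((outside ∷ A) ∷_)) (φ₀ ∘ (A ∷_)) (φ₂ ∘ (A ∷_)) ℓ X Y)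
             (sym (∑ᴸ-map φ′ (A ∷_) (sublists ℓ X)))))
         (∑-sublists-inside φ φ₀ φ₂ (suc ℓ) X Y) ⟩
  ∑ᴸ φ′ (map (A ∷_) (sublists ℓ X)) + ∑ᴸ φ′ (sublists (suc ℓ) X)
    ≡⟨ ∑ᴸ-++ φ′ (map (A ∷_) (sublists ℓ X)) _ ⟨
  ∑ᴸ φ′ (sublists (suc ℓ) (A ∷ X)) ∎
  where
  Z = map (outside ∷_) X ++ map (inside ∷_) Y
  φ′ : List (Subset _) → ℤ
  φ′ G = ∑ᴸ (λ B → φ (map (outside ∷_) G ++ (inside ∷ B) ∷ [])) Y

-- There are C(|T|,k) ways to choose `B` with k elements of `T` left over. Element by element: a
-- member of `T` is either left over or put into `B`, which gives the two terms of Pascal's rule,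
-- and a non-member cannot be in `B`.
∑-subsets-⊆ : ∀ {r} (T : Subset r) f →
  ∑ᴸ (λ B → χ (B ⊆? T) * f ∣ T ─ B ∣) (subsets r) ≡ binomialSum f ∣ T ∣
∑-subsets-⊆ []            f = trans (+-identityʳ _) (*-identityˡ (f 0))
∑-subsets-⊆ {suc r} (t ∷ T) f =
  trans (∑ᴸ-cartesianProductWith φ _∷_ (outside ∷ inside ∷ []) (subsets r))
        (trans (cong (∑ᴸ (φ ∘ (outside ∷_)) (subsets r) +_) (+-identityʳ _)) (split t φ (λ _ → refl)))
  where
  φ : Subset (suc r) → ℤ
  φ B = χ (B ⊆? (t ∷ T)) * f ∣ (t ∷ T) ─ B ∣
  split : ∀ t (φ : Subset (suc r) → ℤ) → (∀ B → φ B ≡ χ (B ⊆? (t ∷ T)) * f ∣ (t ∷ T) ─ B ∣) →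
    ∑ᴸ (φ ∘ (outside ∷_)) (subsets r) + ∑ᴸ (φ ∘ (inside ∷_)) (subsets r) ≡ binomialSum f ∣ t ∷ T ∣
  split inside φ φ≡ = begin
    ∑ᴸ (φ ∘ (outside ∷_)) (subsets r) + ∑ᴸ (φ ∘ (inside ∷_)) (subsets r)
      ≡⟨ cong₂ _+_
           (trans (∑ᴸ-cong (λ B → trans (φ≡ (outside ∷ B)) (cong (_* f (suc ∣ T ─ B ∣))
                     (χ-cong drop-∷-⊆ out⊆ ((outside ∷ B) ⊆? (inside ∷ T)) (B ⊆? T)))) (subsets r))
                  (∑-subsets-⊆ T (f ∘ suc)))
           (trans (∑ᴸ-cong (λ B → trans (φ≡ (inside ∷ B)) (cong (_* f ∣ T ─ B ∣)
                     (χ-cong drop-∷-⊆ in⊆in ((inside ∷ B) ⊆? (inside ∷ T)) (B ⊆? T)))) (subsets r))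
                  (∑-subsets-⊆ T f)) ⟩
    binomialSum (f ∘ suc) ∣ T ∣ + binomialSum f ∣ T ∣
      ≡⟨ +-comm (binomialSum (f ∘ suc) ∣ T ∣) _ ⟩
    binomialSum f ∣ inside ∷ T ∣ ∎
  split outside φ φ≡ = begin
    ∑ᴸ (φ ∘ (outside ∷_)) (subsets r) + ∑ᴸ (φ ∘ (inside ∷_)) (subsets r)
      ≡⟨ cong₂ _+_
           (trans (∑ᴸ-cong (λ B → trans (φ≡ (outside ∷ B)) (cong (_* f ∣ T ─ B ∣)
                     (χ-cong drop-∷-⊆ out⊆ ((outside ∷ B) ⊆? (outside ∷ T)) (B ⊆? T)))) (subsets r))
                  (∑-subsets-⊆ T f))
           (∑ᴸ-zero (λ B → trans (φ≡ (inside ∷ B)) (cong (_* f ∣ T ─ B ∣)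
                     (χ-no (λ B⊆T → case B⊆T here of λ ()) ((inside ∷ B) ⊆? (outside ∷ T))))) (subsets r)) ⟩
    binomialSum f ∣ T ∣ + 0ℤ
      ≡⟨ +-identityʳ _ ⟩
    binomialSum f ∣ outside ∷ T ∣ ∎

-- Induction on the ambient size `r`. If the first element is not in `T`, it is dropped from all
-- blocks; if it is, the sum runs over the rest `B` of its block, and the hypothesis is applied to
-- `T ─ B`.
partitions≡stirling : ∀ {r} ℓ (T : Subset r) →
  ∑ᴸ (λ F → χ (isPartitionOf? T F)) (sublists ℓ (subsets r)) ≡ stirling ℓ ∣ T ∣
partitions≡stirling zero    []            = refl
partitions≡stirling (suc zero)    []      = refl
partitions≡stirling (suc (suc ℓ)) []      = refl
partitions≡stirling {suc r} ℓ (outside ∷ T) = begin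
  ∑ᴸ φ (sublists ℓ (subsets (suc r)))
    ≡⟨ cong (∑ᴸ φ ∘ sublists ℓ) (cong (map (outside ∷_) (subsets r) ++_) (++-identityʳ _)) ⟩
  ∑ᴸ φ (sublists ℓ (map (outside ∷_) (subsets r) ++ map (inside ∷_) (subsets r)))
    ≡⟨ ∑-sublists-outside φ (λ G B H → χ-no (¬partition-outside T G B H) (isPartitionOf? _ _)) ℓ (subsets r) (subsets r) ⟩
  ∑ᴸ (φ ∘ map (outside ∷_)) (sublists ℓ (subsets r))
    ≡⟨ ∑ᴸ-cong (λ G → χ-cong (partition-outside⁻ G) partition-outside⁺ (isPartitionOf? _ _) (isPartitionOf? T G))
               (sublists ℓ (subsets r)) ⟩
  ∑ᴸ (λ G → χ (isPartitionOf? T G)) (sublists ℓ (subsets r))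
    ≡⟨ partitions≡stirling ℓ T ⟩
  stirling ℓ ∣ T ∣ ∎
  where
  φ : List (Subset (suc r)) → ℤ
  φ F = χ (isPartitionOf? (outside ∷ T) F)
partitions≡stirling {suc r} zero (inside ∷ T) =
  cong (_+ 0ℤ) (χ-no (¬partition-inside₀ T []) (isPartitionOf? (inside ∷ T) []))
partitions≡stirling {suc r} (suc ℓ) (inside ∷ T) = begin
  ∑ᴸ φ (sublists (suc ℓ) (subsets (suc r)))
    ≡⟨ cong (∑ᴸ φ ∘ sublists (suc ℓ)) (cong (map (outside ∷_) (subsets r) ++_) (++-identityʳ _)) ⟩
  ∑ᴸ φ (sublists (suc ℓ) (map (outside ∷_) (subsets r) ++ map (inside ∷_) (subsets r)))
    ≡⟨ ∑-sublists-inside φ (λ G → χ-no (¬partition-inside₀ T G) (isPartitionOf? _ _))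
         (λ G B G′ B′ H → χ-no (¬partition-inside₂ T G B G′ B′ H) (isPartitionOf? _ _)) ℓ (subsets r) (subsets r) ⟩
  ∑ᴸ (λ G → ∑ᴸ (λ B → φ (map (outside ∷_) G ++ (inside ∷ B) ∷ [])) (subsets r)) (sublists ℓ (subsets r))
    -- The ground set `T ─ B` of the smaller partition depends on `B`, so `B` has to be fixed first.
    ≡⟨ ∑ᴸ-comm (λ G B → φ (map (outside ∷_) G ++ (inside ∷ B) ∷ [])) (sublists ℓ (subsets r)) (subsets r) ⟩
  ∑ᴸ (λ B → ∑ᴸ (λ G → φ (map (outside ∷_) G ++ (inside ∷ B) ∷ [])) (sublists ℓ (subsets r))) (subsets r)
    ≡⟨ ∑ᴸ-cong (λ B → begin
         ∑ᴸ (λ G → φ (map (outside ∷_) G ++ (inside ∷ B) ∷ [])) (sublists ℓ (subsets r))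
           ≡⟨ ∑ᴸ-cong (λ G → trans
                (χ-cong (partition-inside⁻ G B) (λ (B⊆T , p) → partition-inside⁺ B⊆T p)
                  (isPartitionOf? _ _) (B ⊆? T ×-dec isPartitionOf? (T ─ B) G))
                (χ-× (B ⊆? T) (isPartitionOf? (T ─ B) G))) (sublists ℓ (subsets r)) ⟩
         ∑ᴸ (λ G → χ (B ⊆? T) * χ (isPartitionOf? (T ─ B) G)) (sublists ℓ (subsets r))
           ≡⟨ ∑ᴸ-*ˡ (χ (B ⊆? T)) _ (sublists ℓ (subsets r)) ⟩
         χ (B ⊆? T) * ∑ᴸ (λ G → χ (isPartitionOf? (T ─ B) G)) (sublists ℓ (subsets r))
           ≡⟨ cong (χ (B ⊆? T) *_) (partitions≡stirling ℓ (T ─ B)) ⟩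
         χ (B ⊆? T) * stirling ℓ ∣ T ─ B ∣ ∎) (subsets r) ⟩
  ∑ᴸ (λ B → χ (B ⊆? T) * stirling ℓ ∣ T ─ B ∣) (subsets r)
    ≡⟨ ∑-subsets-⊆ T (stirling ℓ) ⟩
  binomialSum (stirling ℓ) ∣ T ∣ ∎
  where
  φ : List (Subset (suc r)) → ℤ
  φ F = χ (isPartitionOf? (inside ∷ T) F)

S≡stirling : ∀ r ℓ → pos (S r ℓ) ≡ stirling ℓ r
S≡stirling r ℓ = begin
  pos (S r ℓ)
    ≡⟨ length-filter≡∑χ isSetPartition? (sublists ℓ (subsets r)) ⟩
  ∑ᴸ (χ ∘ isPartitionOf? ⊤) (sublists ℓ (subsets r))
    ≡⟨ partitions≡stirling ℓ ⊤ ⟩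
  stirling ℓ ∣ ⊤ {r} ∣
    ≡⟨ cong (stirling ℓ) (∣⊤∣≡n r) ⟩
  stirling ℓ r ∎

-- The major index and Carlitz's insertion argument.

-- The contribution of a possible descent at place `k`. The later of the two adjacent values is the
-- first argument.
jump : ℕ → ℕ → ℕ → ℕ
jump a b k with a <? b
... | yes _ = k
... | no  _ = 0

jump-< : ∀ {a b} k → a < b → jump a b k ≡ k
jump-< {a} {b} k a<b with a <? b
... | yes _   = refl
... | no  a≮b = contradiction a<b a≮b

jump-≮ : ∀ {a b} k → ¬ a < b → jump a b k ≡ 0
jump-≮ {a} {b} k a≮b with a <? b
... | yes a<b = contradiction a<b a≮b
... | no  _   = refl

jump-> : ∀ {a b} k → b < a → jump a b k ≡ 0
jump-> k b<a = jump-≮ k (ℕ.<-asym b<a)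

-- The major index is taken of arbitrary sequences of naturals, so that it also applies to the
-- initial segments of a permutation.
maj : (Fin n → ℕ) → ℕ
maj {zero}  σ = 0
maj {suc n} σ = ℕΣ.sum (λ i → jump (σ (suc i)) (σ (inject₁ i)) (suc (toℕ i)))

maj-cong : {σ τ : Fin n → ℕ} → σ ≗ τ → maj σ ≡ maj τ
maj-cong {zero}  σ≗τ = refl
maj-cong {suc n} σ≗τ = ℕΣ.sum-cong-≗ λ i → cong₂ (λ a b → jump a b _) (σ≗τ (suc i)) (σ≗τ (inject₁ i))

maj-init-last : ∀ (σ : Fin (2 ℕ.+ n) → ℕ) →
  maj σ ≡ maj (σ ∘ inject₁) ℕ.+ jump (σ (fromℕ (suc n))) (σ (inject₁ (fromℕ n))) (suc n)
maj-init-last {n} σ = trans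
  (ℕΣ.sum-init-last (λ i → jump (σ (suc i)) (σ (inject₁ i)) (suc (toℕ i))))
  (cong₂ ℕ._+_
    (ℕΣ.sum-cong-≗ λ i → cong (λ k → jump (σ (suc (inject₁ i))) (σ (inject₁ (inject₁ i))) (suc k)) (toℕ-inject₁ i))
    (cong (λ k → jump (σ (fromℕ (suc n))) (σ (inject₁ (fromℕ n))) (suc k)) (toℕ-fromℕ n)))

maj-toℕ : ∀ n → maj {n} toℕ ≡ 0
maj-toℕ zero    = refl
maj-toℕ (suc n) = trans
  (ℕΣ.sum-cong-≗ {n} λ i → jump-> (suc (toℕ i)) (s≤s (ℕ.≤-reflexive (toℕ-inject₁ i))))
  (ℕΣ.sum-replicate-zero n)

maj-append-max : ∀ {σ : Fin n → ℕ} {τ : Fin (suc n) → ℕ} {N} →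
  (∀ x → σ x < N) → τ ∘ inject₁ ≗ σ → τ (fromℕ n) ≡ N → maj τ ≡ maj σ
maj-append-max {zero}  σ<N τ≗σ τ≡N = refl
maj-append-max {suc n} {σ} {τ} {N} σ<N τ≗σ τ≡N = begin
  maj τ
    ≡⟨ maj-init-last τ ⟩
  maj (τ ∘ inject₁) ℕ.+ jump (τ (fromℕ (suc n))) (τ (inject₁ (fromℕ n))) (suc n)
    ≡⟨ cong₂ ℕ._+_ (maj-cong τ≗σ)
         (jump-> (suc n) (subst₂ _<_ (sym (τ≗σ (fromℕ n))) (sym τ≡N) (σ<N (fromℕ n)))) ⟩
  maj σ ℕ.+ 0
    ≡⟨ ℕ.+-identityʳ _ ⟩
  maj σ ∎

punchIn-fromℕ : ∀ (x : Fin n) → punchIn (fromℕ n) x ≡ inject₁ x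
punchIn-fromℕ zero    = refl
punchIn-fromℕ (suc x) = cong suc (punchIn-fromℕ x)

punchIn-inject₁ : ∀ (j : Fin (suc n)) x → punchIn (inject₁ j) (inject₁ x) ≡ inject₁ (punchIn j x)
punchIn-inject₁ zero    x       = refl
punchIn-inject₁ (suc j) zero    = refl
punchIn-inject₁ (suc j) (suc x) = cong suc (punchIn-inject₁ j x)

punchIn-inject₁-fromℕ : ∀ (j : Fin (suc n)) → punchIn (inject₁ j) (fromℕ n) ≡ fromℕ (suc n)
punchIn-inject₁-fromℕ         zero    = refl
punchIn-inject₁-fromℕ {suc n} (suc j) = cong suc (punchIn-inject₁-fromℕ j)

-- All sequences `τ j` obtained from `σ` by putting a new maximum `N` at place `j`. They are
-- characterised by their values instead of being constructed, so that initial segments and lists of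
-- positions are instances as they stand.
record Insertions (σ : Fin n → ℕ) (N : ℕ) (τ : Fin (suc n) → Fin (suc n) → ℕ) : Set where
  field
    bound : ∀ x → σ x < N
    old   : ∀ j x → τ j (punchIn j x) ≡ σ x
    new   : ∀ j → τ j j ≡ N

open Insertions

insertions-init : ∀ {σ : Fin (suc n) → ℕ} {N τ} → Insertions σ N τ →
  Insertions (σ ∘ inject₁) N (λ j → τ (inject₁ j) ∘ inject₁)
insertions-init {τ = τ} ins = record
  { bound = bound ins ∘ inject₁
  ; old   = λ j x → trans (cong (τ (inject₁ j)) (sym (punchIn-inject₁ j x))) (old ins (inject₁ j) (inject₁ x))
  ; new   = new ins ∘ inject₁
  }

maj-insert-last : ∀ {σ : Fin n → ℕ} {N τ} → Insertions σ N τ → maj (τ (fromℕ n)) ≡ maj σ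
maj-insert-last {τ = τ} ins = maj-append-max {τ = τ (fromℕ _)} (bound ins)
  (λ x → trans (cong (τ _) (sym (punchIn-fromℕ x))) (old ins _ x)) (new ins _)

old-last : ∀ {σ : Fin (suc n) → ℕ} {N τ} → Insertions σ N τ → ∀ j →
  τ (inject₁ j) (fromℕ (suc n)) ≡ σ (fromℕ n)
old-last {τ = τ} ins j =
  trans (cong (τ (inject₁ j)) (sym (punchIn-inject₁-fromℕ j))) (old ins (inject₁ j) (fromℕ _))

-- The new maximum ends the initial segment without creating a descent there, and then descends to
-- the last value of `σ` at place `suc n`. It separates the last two values of `σ`, so a descent
-- between them is lost; hence `σ ∘ inject₁`.
maj-insert-penultimate : ∀ {σ : Fin (suc n) → ℕ} {N τ} → Insertions σ N τ →
  maj (τ (inject₁ (fromℕ n))) ≡ suc n ℕ.+ maj (σ ∘ inject₁)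
maj-insert-penultimate {n} {σ} {N} {τ} ins = begin
  maj τ′
    ≡⟨ maj-init-last τ′ ⟩
  maj (τ′ ∘ inject₁) ℕ.+ jump (τ′ (fromℕ (suc n))) (τ′ (inject₁ (fromℕ n))) (suc n)
    ≡⟨ cong₂ ℕ._+_ (maj-insert-last (insertions-init ins))
         (jump-< (suc n) (subst₂ _<_ (sym (old-last ins (fromℕ n))) (sym (new ins _)) (bound ins (fromℕ n)))) ⟩
  maj (σ ∘ inject₁) ℕ.+ suc n
    ≡⟨ ℕ.+-comm (maj (σ ∘ inject₁)) (suc n) ⟩
  suc n ℕ.+ maj (σ ∘ inject₁) ∎
  where τ′ = τ (inject₁ (fromℕ n))

-- The insertions before the end raise the major index by 1, ..., `n`. Which place yields which
-- increment depends on the descents of `σ`, so the claim is about the sum over all places. The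
-- induction splits off the insertion just before the last value.
∑-maj-insert-init : ∀ {σ : Fin n → ℕ} {N τ} → Insertions σ N τ → ∀ (h : ℕ → ℤ) →
  ∑[ j < n ] h (maj (τ (inject₁ j))) ≡ ∑[ i < n ] h (suc (toℕ i) ℕ.+ maj σ)
∑-maj-insert-init {zero}        ins h = refl
∑-maj-insert-init {suc zero}    ins h = cong (λ k → h k + 0ℤ) (maj-insert-penultimate ins)
∑-maj-insert-init {suc (suc n)} {σ} {N} {τ} ins h = begin
  ∑[ j < 2 ℕ.+ n ] h (maj (τ (inject₁ j)))
    ≡⟨ sum-init-last {suc n} (λ j → h (maj (τ (inject₁ j)))) ⟩
  ∑[ j < suc n ] h (maj (τ (inject₁ (inject₁ j)))) + h (maj (τ (inject₁ (fromℕ (suc n)))))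
    ≡⟨ cong₂ _+_ (sum-cong-≗ {suc n} λ j → cong h (maj-insert-inner j)) (cong h (maj-insert-penultimate ins)) ⟩
  ∑[ j < suc n ] h (maj (τ (inject₁ (inject₁ j)) ∘ inject₁) ℕ.+ D (2 ℕ.+ n)) + h (2 ℕ.+ n ℕ.+ M)
    -- An insertion further left keeps the last two values adjacent but moves them one place on, so
    -- their descent now counts `2 + n`. This constant is absorbed into the functional for the
    -- induction hypothesis.
    ≡⟨ cong (_+ h (2 ℕ.+ n ℕ.+ M)) (∑-maj-insert-init (insertions-init ins) (λ k → h (k ℕ.+ D (2 ℕ.+ n)))) ⟩
  ∑[ i < suc n ] h (suc (toℕ i) ℕ.+ M ℕ.+ D (2 ℕ.+ n)) + h (2 ℕ.+ n ℕ.+ M)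
    ≡⟨ byCases (σ (fromℕ (suc n)) <? σ (inject₁ (fromℕ n))) ⟩
  ∑[ i < 2 ℕ.+ n ] h (suc (toℕ i) ℕ.+ (M ℕ.+ D (suc n)))
    ≡⟨ sum-cong-≗ {2 ℕ.+ n} (λ i → cong (λ k → h (suc (toℕ i) ℕ.+ k)) (maj-init-last σ)) ⟨
  ∑[ i < 2 ℕ.+ n ] h (suc (toℕ i) ℕ.+ maj σ) ∎
  where
  M : ℕ
  M = maj (σ ∘ inject₁)
  D : ℕ → ℕ
  D = jump (σ (fromℕ (suc n))) (σ (inject₁ (fromℕ n)))
  maj-insert-inner : ∀ j → maj (τ (inject₁ (inject₁ j))) ≡ maj (τ (inject₁ (inject₁ j)) ∘ inject₁) ℕ.+ D (2 ℕ.+ n)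
  maj-insert-inner j = trans (maj-init-last (τ (inject₁ (inject₁ j))))
    (cong₂ (λ a b → maj (τ (inject₁ (inject₁ j)) ∘ inject₁) ℕ.+ jump a b (2 ℕ.+ n))
      (old-last ins (inject₁ j)) (old-last (insertions-init ins) j))
  byCases : Dec (σ (fromℕ (suc n)) < σ (inject₁ (fromℕ n))) →
    ∑[ i < suc n ] h (suc (toℕ i) ℕ.+ M ℕ.+ D (2 ℕ.+ n)) + h (2 ℕ.+ n ℕ.+ M)
      ≡ ∑[ i < 2 ℕ.+ n ] h (suc (toℕ i) ℕ.+ (M ℕ.+ D (suc n)))
  -- If `σ` ends in a descent, then `maj σ` is `M + suc n`, and the insertion just before the last
  -- value gives the smallest increment, 1. Its term is moved to the front.
  byCases (yes d) = begin
    ∑[ i < suc n ] h (suc (toℕ i) ℕ.+ M ℕ.+ D (2 ℕ.+ n)) + h (2 ℕ.+ n ℕ.+ M)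
      ≡⟨ +-comm (∑[ i < suc n ] h (suc (toℕ i) ℕ.+ M ℕ.+ D (2 ℕ.+ n))) _ ⟩
    h (2 ℕ.+ n ℕ.+ M) + ∑[ i < suc n ] h (suc (toℕ i) ℕ.+ M ℕ.+ D (2 ℕ.+ n))
      ≡⟨ cong₂ _+_
           (cong h (trans (rotate n M) (cong (λ k → 1 ℕ.+ (M ℕ.+ k)) (sym (jump-< (suc n) d)))))
           (sum-cong-≗ {suc n} (λ i → cong h (trans (cong (suc (toℕ i) ℕ.+ M ℕ.+_) (jump-< (2 ℕ.+ n) d))
             (trans (shift (toℕ i) M n) (cong (λ k → 2 ℕ.+ toℕ i ℕ.+ (M ℕ.+ k)) (sym (jump-< (suc n) d))))))) ⟩
    ∑[ i < 2 ℕ.+ n ] h (suc (toℕ i) ℕ.+ (M ℕ.+ D (suc n))) ∎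
    where
    rotate : ∀ n M → 2 ℕ.+ n ℕ.+ M ≡ 1 ℕ.+ (M ℕ.+ suc n)
    rotate = ℕ.solve-∀
    shift : ∀ i M n → suc i ℕ.+ M ℕ.+ (2 ℕ.+ n) ≡ 2 ℕ.+ i ℕ.+ (M ℕ.+ suc n)
    shift = ℕ.solve-∀
  -- Otherwise `maj σ` is `M`, and the same insertion gives the largest increment, `2 + n`. Its term
  -- stays at the end.
  byCases (no ¬d) = begin
    ∑[ i < suc n ] h (suc (toℕ i) ℕ.+ M ℕ.+ D (2 ℕ.+ n)) + h (2 ℕ.+ n ℕ.+ M)
      ≡⟨ cong₂ _+_
           (sum-cong-≗ {suc n} (λ i → cong h (trans (ℕ.+-assoc (suc (toℕ i)) M _)
             (cong₂ (λ a b → suc a ℕ.+ (M ℕ.+ b)) (sym (toℕ-inject₁ i))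
               (trans (jump-≮ (2 ℕ.+ n) ¬d) (sym (jump-≮ (suc n) ¬d)))))))
           (cong h (cong₂ (λ a b → suc a ℕ.+ b) (sym (toℕ-fromℕ (suc n)))
             (trans (sym (ℕ.+-identityʳ M)) (cong (M ℕ.+_) (sym (jump-≮ (suc n) ¬d)))))) ⟩
    ∑[ i < suc n ] h (suc (toℕ (inject₁ i)) ℕ.+ (M ℕ.+ D (suc n)))
      + h (suc (toℕ (fromℕ (suc n))) ℕ.+ (M ℕ.+ D (suc n)))
      ≡⟨ sum-init-last {suc n} (λ i → h (suc (toℕ i) ℕ.+ (M ℕ.+ D (suc n)))) ⟨
    ∑[ i < 2 ℕ.+ n ] h (suc (toℕ i) ℕ.+ (M ℕ.+ D (suc n))) ∎

-- Insertion at the end creates no descent; it supplies the missing increment 0.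
∑-maj-insert : ∀ {σ : Fin n → ℕ} {N τ} → Insertions σ N τ → ∀ (h : ℕ → ℤ) →
  ∑[ j < suc n ] h (maj (τ j)) ≡ window (suc n) h (maj σ)
∑-maj-insert {n} {σ} {τ = τ} ins h = begin
  ∑[ j < suc n ] h (maj (τ j))
    ≡⟨ sum-init-last {n} (λ j → h (maj (τ j))) ⟩
  ∑[ j < n ] h (maj (τ (inject₁ j))) + h (maj (τ (fromℕ n)))
    ≡⟨ cong₂ _+_ (∑-maj-insert-init ins h) (cong h (maj-insert-last ins)) ⟩
  ∑[ i < n ] h (suc (toℕ i) ℕ.+ maj σ) + h (maj σ)
    ≡⟨ +-comm _ (h (maj σ)) ⟩
  window (suc n) h (maj σ) ∎

-- Positions in one-line notation.

-- A total substitute for the index of a membership proof. An absent letter is sent to the length of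
-- the list.
position : List (Fin n) → Fin n → ℕ
position []       x = 0
position (y ∷ ys) x with x ≟ y
... | yes _ = 0
... | no  _ = suc (position ys x)

position-here : ∀ (x : Fin n) xs → position (x ∷ xs) x ≡ 0
position-here x xs with x ≟ x
... | yes _  = refl
... | no x≢x = contradiction refl x≢x

position-there : ∀ {x y : Fin n} xs → x ≢ y → position (y ∷ xs) x ≡ suc (position xs x)
position-there {x = x} {y} xs x≢y with x ≟ y
... | yes x≡y = contradiction x≡y x≢y
... | no _    = refl

-- In a list without repetitions every membership proof points to the first occurrence.
index≡position : ∀ {x : Fin n} {xs} → Unique xs → (x∈xs : x ∈ xs) → toℕ (Any.index x∈xs) ≡ position xs x
index≡position (_ ∷ _)       (here refl)  = sym (position-here _ _)
index≡position {xs = _ ∷ xs} (y∉xs ∷ xs!) (there x∈xs) =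
  trans (cong suc (index≡position xs! x∈xs))
        (sym (position-there xs (λ { refl → All.lookup y∉xs x∈xs refl })))

position<length : ∀ {x : Fin n} {xs} → x ∈ xs → position xs x < length xs
position<length {x = x} {y ∷ xs} x∈ with x ≟ y | x∈
... | yes _   | _           = s≤s z≤n
... | no x≢y  | here x≡y    = contradiction x≡y x≢y
... | no _    | there x∈xs  = s≤s (position<length x∈xs)

position-tabulate : ∀ {m} (f : Fin m → Fin n) → (∀ {i j} → f i ≡ f j → i ≡ j) →
  ∀ i → position (tabulate f) (f i) ≡ toℕ i
position-tabulate f f-inj zero    = position-here (f zero) _
position-tabulate f f-inj (suc i) = trans
  (position-there (tabulate (f ∘ suc)) (λ eq → contradiction (f-inj eq) λ ()))
  (cong suc (position-tabulate (f ∘ suc) (suc-injective ∘ f-inj) i))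

-- Appending the letter `j` to the one-line notation keeps the positions of the old letters, and by
-- `position-hole` the new letter gets a position beyond all of them. For the inverse permutation
-- this is the insertion of a new maximum at place `j`.
position-map-punchIn : ∀ (j : Fin (suc n)) {x xs} → x ∈ xs →
  position (map (punchIn j) xs ++ j ∷ []) (punchIn j x) ≡ position xs x
position-map-punchIn j {x} {y ∷ xs} x∈ with x ≟ y | x∈
... | yes refl | _           = position-here (punchIn j x) _
... | no x≢y   | here x≡y    = contradiction x≡y x≢y
... | no x≢y   | there x∈xs  = trans
  (position-there (map (punchIn j) xs ++ j ∷ []) (x≢y ∘ punchIn-injective j x y))
  (cong suc (position-map-punchIn j x∈xs))

position-hole : ∀ (j : Fin (suc n)) xs → position (map (punchIn j) xs ++ j ∷ []) j ≡ length xs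
position-hole j []       = position-here j []
position-hole j (x ∷ xs) = trans
  (position-there (map (punchIn j) xs ++ j ∷ []) (punchInᵢ≢i j x ∘ sym))
  (cong suc (position-hole j xs))

sum-filter-tabulate : ∀ {m} {P : Fin n → Set} (P? : Decidable P) (f : Fin n → ℕ) (g : Fin m → Fin n)
  (φ : Fin m → ℕ) → (∀ i → P (g i) → φ i ≡ f (g i)) → (∀ i → ¬ P (g i) → φ i ≡ 0) →
  ℕ.sum (map f (filter P? (tabulate g))) ≡ ℕΣ.sum φ
sum-filter-tabulate {m = zero}  P? f g φ yes! no! = refl
sum-filter-tabulate {m = suc m} P? f g φ yes! no! with P? (g zero)
... | yes p = cong₂ ℕ._+_ (sym (yes! zero p)) (sum-filter-tabulate P? f (g ∘ suc) (φ ∘ suc) (yes! ∘ suc) (no! ∘ suc))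
... | no ¬p = trans (sum-filter-tabulate P? f (g ∘ suc) (φ ∘ suc) (yes! ∘ suc) (no! ∘ suc))
                    (cong (ℕ._+ ℕΣ.sum (φ ∘ suc)) (sym (no! zero ¬p)))

-- The backsteps of a permutation are the descents of its inverse.
imaj≡maj : ∀ (v : Permutation′ n) → imaj v ≡ maj (toℕ ∘ (v ⟨$⟩ˡ_))
imaj≡maj {zero}  v = refl
imaj≡maj {suc n} v = sum-filter-tabulate (isBackstep? v) (suc ∘ toℕ) id _
  (λ i → jump-< (suc (toℕ i))) (λ i → jump-≮ (suc (toℕ i)))

imaj-w : ∀ (a : Vec (Fin n) r) → imaj (w a) ≡ maj (position (oneLine a))
imaj-w {n} a = trans (imaj≡maj (w a)) (maj-cong λ i →
  trans (toℕ-cast _ (Any.index (oneLine-complete a i)))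
        (index≡position (keepRightmost-unique (allFin n ++ Vec.toList a)) (oneLine-complete a i)))

-- Sums over words.

-- The summand takes lists and not vectors, because deleting a letter from words of one length
-- produces words of different lengths.
∑ᵂ : ℕ → (List (Fin n) → ℤ) → ℤ
∑ᵂ         zero    f = f []
∑ᵂ {n = n} (suc r) f = ∑[ x < n ] ∑ᵂ r (f ∘ (x ∷_))

∑ᴸ-words : ∀ r (f : List (Fin n) → ℤ) → ∑ᴸ (f ∘ Vec.toList) (words n r) ≡ ∑ᵂ r f
∑ᴸ-words         zero    f = +-identityʳ (f [])
∑ᴸ-words {n = n} (suc r) f = begin
  ∑ᴸ (f ∘ Vec.toList) (words n (suc r))
    ≡⟨ ∑ᴸ-cartesianProductWith (f ∘ Vec.toList) Vec._∷_ (allFin n) (words n r) ⟩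
  ∑ᴸ (λ x → ∑ᴸ (f ∘ (x ∷_) ∘ Vec.toList) (words n r)) (allFin n)
    ≡⟨ ∑ᴸ-cong (λ x → ∑ᴸ-words r (f ∘ (x ∷_))) (allFin n) ⟩
  ∑ᴸ (λ x → ∑ᵂ r (f ∘ (x ∷_))) (allFin n)
    ≡⟨ ∑ᴸ-tabulate (λ x → ∑ᵂ r (f ∘ (x ∷_))) id ⟩
  ∑ᵂ (suc r) f ∎

∑ᵂ-cong : ∀ r {f g : List (Fin n) → ℤ} → f ≗ g → ∑ᵂ r f ≡ ∑ᵂ r g
∑ᵂ-cong zero    f≗g = f≗g []
∑ᵂ-cong (suc r) f≗g = sum-cong-≗ λ x → ∑ᵂ-cong r (f≗g ∘ (x ∷_))

∑ᵂ-∑ : ∀ {m} r (f : Fin m → List (Fin n) → ℤ) →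
  ∑[ j < m ] ∑ᵂ r (f j) ≡ ∑ᵂ r (λ a → ∑[ j < m ] f j a)
∑ᵂ-∑         zero    f = refl
∑ᵂ-∑ {n = n} (suc r) f = trans (∑-comm (λ j x → ∑ᵂ r (f j ∘ (x ∷_))))
  (sum-cong-≗ {n} λ x → ∑ᵂ-∑ r (λ j → f j ∘ (x ∷_)))

-- Words grow at the front, whereas the recursion on the alphabet fixes the last letter.
∑ᵂ-init-last : ∀ r (f : List (Fin n) → ℤ) →
  ∑ᵂ (suc r) f ≡ ∑[ j < n ] ∑ᵂ r (λ a → f (a ++ j ∷ []))
∑ᵂ-init-last         zero    f = refl
∑ᵂ-init-last {n = n} (suc r) f = trans
  (sum-cong-≗ {n} λ x → ∑ᵂ-init-last r (f ∘ (x ∷_)))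
  (∑-comm {n} {n} (λ x j → ∑ᵂ r (λ a → f (x ∷ a ++ j ∷ []))))

-- Deleting a letter from a word.

data PunchView (j : Fin (suc n)) : Fin (suc n) → Set where
  hole    : PunchView j j
  punched : ∀ x → PunchView j (punchIn j x)

punchView : ∀ (j x : Fin (suc n)) → PunchView j x
punchView j x with j ≟ x
... | yes refl = hole
... | no j≢x   = subst (PunchView j) (punchIn-punchOut j≢x) (punched (punchOut j≢x))

delete : Fin (suc n) → List (Fin (suc n)) → List (Fin n)
delete j []       = []
delete j (x ∷ xs) with j ≟ x
... | yes _  = delete j xs
... | no j≢x = punchOut j≢x ∷ delete j xs

delete-hole : ∀ (j : Fin (suc n)) xs → delete j (j ∷ xs) ≡ delete j xs
delete-hole j xs with j ≟ j
... | yes _  = refl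
... | no j≢j = contradiction refl j≢j

delete-punchIn : ∀ (j : Fin (suc n)) x xs → delete j (punchIn j x ∷ xs) ≡ x ∷ delete j xs
delete-punchIn j x xs with j ≟ punchIn j x
... | yes j≡ = contradiction (sym j≡) (punchInᵢ≢i j x)
... | no j≢  = cong (_∷ delete j xs) (trans (punchOut-cong j refl) (punchOut-punchIn j))

delete-++ : ∀ (j : Fin (suc n)) xs ys → delete j (xs ++ ys) ≡ delete j xs ++ delete j ys
delete-++ j []       ys = refl
delete-++ j (x ∷ xs) ys with j ≟ x
... | yes _  = delete-++ j xs ys
... | no j≢x = cong (punchOut j≢x ∷_) (delete-++ j xs ys)

delete-tabulate-punchIn : ∀ (j : Fin (suc n)) {m} (f : Fin m → Fin n) →
  delete j (tabulate (punchIn j ∘ f)) ≡ tabulate f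
delete-tabulate-punchIn j {zero}  f = refl
delete-tabulate-punchIn j {suc m} f =
  trans (delete-punchIn j (f zero) _) (cong (f zero ∷_) (delete-tabulate-punchIn j (f ∘ suc)))

delete-suc-map-suc : ∀ (j : Fin (suc n)) xs → delete (suc j) (map suc xs) ≡ map suc (delete j xs)
delete-suc-map-suc j []       = refl
delete-suc-map-suc j (x ∷ xs) with punchView j x
... | hole      = trans (delete-hole (suc j) _) (trans (delete-suc-map-suc j xs) (cong (map suc) (sym (delete-hole j xs))))
... | punched y = trans (delete-punchIn (suc j) (suc y) _)
  (trans (cong (suc y ∷_) (delete-suc-map-suc j xs)) (cong (map suc) (sym (delete-punchIn j y xs))))

delete-allFin : ∀ (j : Fin (suc n)) → delete j (allFin (suc n)) ≡ allFin n
delete-allFin         zero    = delete-tabulate-punchIn zero id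
delete-allFin {suc n} (suc j) = cong (zero ∷_) (begin
  delete (suc j) (tabulate suc)              ≡⟨ cong (delete (suc j)) (map-tabulate id suc) ⟨
  delete (suc j) (map suc (allFin (suc n)))  ≡⟨ delete-suc-map-suc j (allFin (suc n)) ⟩
  map suc (delete j (allFin (suc n)))        ≡⟨ cong (map suc) (delete-allFin j) ⟩
  map suc (allFin n)                         ≡⟨ map-tabulate id suc ⟩
  tabulate suc                               ∎)

-- Pascal's rule again: the first letter is either `j` and disappears, or it is one of the `n`
-- others and becomes the first letter of the shorter word.
∑ᵂ-delete : ∀ (j : Fin (suc n)) r (f : List (Fin n) → ℤ) →
  ∑ᵂ r (f ∘ delete j) ≡ binomialSum (λ k → ∑ᵂ k f) r
∑ᵂ-delete         j zero    f = refl
∑ᵂ-delete {n = n} j (suc r) f = begin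
  ∑[ x < suc n ] ∑ᵂ r (f ∘ delete j ∘ (x ∷_))
    ≡⟨ sum-remove {n} {j} (λ x → ∑ᵂ r (f ∘ delete j ∘ (x ∷_))) ⟩
  ∑ᵂ r (f ∘ delete j ∘ (j ∷_)) + ∑[ x < n ] ∑ᵂ r (f ∘ delete j ∘ (punchIn j x ∷_))
    ≡⟨ cong₂ _+_ (∑ᵂ-cong r (cong f ∘ delete-hole j))
                 (sum-cong-≗ {n} λ x → ∑ᵂ-cong r (cong f ∘ delete-punchIn j x)) ⟩
  ∑ᵂ r (f ∘ delete j) + ∑[ x < n ] ∑ᵂ r (f ∘ (x ∷_) ∘ delete j)
    ≡⟨ cong₂ _+_ (∑ᵂ-delete j r f) (sum-cong-≗ {n} λ x → ∑ᵂ-delete j r (f ∘ (x ∷_))) ⟩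
  binomialSum (λ k → ∑ᵂ k f) r + ∑[ x < n ] binomialSum (λ k → ∑ᵂ k (f ∘ (x ∷_))) r
    ≡⟨ cong (binomialSum (λ k → ∑ᵂ k f) r +_) (sum-binomialSum (λ x k → ∑ᵂ k (f ∘ (x ∷_))) r) ⟩
  binomialSum (λ k → ∑ᵂ k f) (suc r) ∎

∈-delete⁺ : ∀ {j : Fin (suc n)} {x xs} → punchIn j x ∈ xs → x ∈ delete j xs
∈-delete⁺ {j = j} {x} (here {xs = xs} refl) = subst (x ∈_) (sym (delete-punchIn j x xs)) (here refl)
∈-delete⁺ {j = j} {x} (there {x = y} x∈xs) with j ≟ y
... | yes _ = ∈-delete⁺ x∈xs
... | no _  = there (∈-delete⁺ x∈xs)

∈-delete⁻ : ∀ (j : Fin (suc n)) {x} xs → x ∈ delete j xs → punchIn j x ∈ xs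
∈-delete⁻ j (y ∷ xs) x∈ with j ≟ y | x∈
... | yes _  | x∈         = there (∈-delete⁻ j xs x∈)
... | no j≢y | here refl  = here (punchIn-punchOut j≢y)
... | no _   | there x∈xs = there (∈-delete⁻ j xs x∈xs)

-- One-line notation of a word with a given last letter.

keepRightmost-∈ : ∀ {x : Fin n} {xs} → x ∈ xs → keepRightmost (x ∷ xs) ≡ keepRightmost xs
keepRightmost-∈ {x = x} {xs} x∈xs with _∈?_ _≟_ x xs
... | yes _   = refl
... | no x∉xs = contradiction x∈xs x∉xs

keepRightmost-∉ : ∀ {x : Fin n} {xs} → x ∉ xs → keepRightmost (x ∷ xs) ≡ x ∷ keepRightmost xs
keepRightmost-∉ {x = x} {xs} x∉xs with _∈?_ _≟_ x xs
... | yes x∈xs = contradiction x∈xs x∉xs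
... | no _     = refl

keepRightmost-unique-id : ∀ {xs : List (Fin n)} → Unique xs → keepRightmost xs ≡ xs
keepRightmost-unique-id []           = refl
keepRightmost-unique-id (x∉xs ∷ xs!) = trans
  (keepRightmost-∉ (λ x∈xs → All.lookup x∉xs x∈xs refl)) (cong (_ ∷_) (keepRightmost-unique-id xs!))

-- The final `j` is the rightmost one, so the earlier ones are all dropped. Whether another letter
-- is kept depends only on its own later occurrences, which deleting `j` preserves.
keepRightmost-∷ʳ : ∀ (j : Fin (suc n)) xs →
  keepRightmost (xs ++ j ∷ []) ≡ map (punchIn j) (keepRightmost (delete j xs)) ++ j ∷ []
keepRightmost-∷ʳ j []       = refl
keepRightmost-∷ʳ j (x ∷ xs) with punchView j x
... | hole = begin
  keepRightmost (j ∷ xs ++ j ∷ [])  ≡⟨ keepRightmost-∈ (∈-++⁺ʳ xs (here refl)) ⟩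
  keepRightmost (xs ++ j ∷ [])      ≡⟨ keepRightmost-∷ʳ j xs ⟩
  map (punchIn j) (keepRightmost (delete j xs)) ++ j ∷ []
    ≡⟨ cong (λ ys → map (punchIn j) (keepRightmost ys) ++ j ∷ []) (delete-hole j xs) ⟨
  map (punchIn j) (keepRightmost (delete j (j ∷ xs))) ++ j ∷ [] ∎
... | punched y = trans (byCases (_∈?_ _≟_ y (delete j xs)))
  (cong (λ ys → map (punchIn j) (keepRightmost ys) ++ j ∷ []) (sym (delete-punchIn j y xs)))
  where
  byCases : Dec (y ∈ delete j xs) → keepRightmost (punchIn j y ∷ xs ++ j ∷ [])
    ≡ map (punchIn j) (keepRightmost (y ∷ delete j xs)) ++ j ∷ []
  byCases (yes y∈) = begin
    keepRightmost (punchIn j y ∷ xs ++ j ∷ [])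
      ≡⟨ keepRightmost-∈ (∈-++⁺ˡ (∈-delete⁻ j xs y∈)) ⟩
    keepRightmost (xs ++ j ∷ [])
      ≡⟨ keepRightmost-∷ʳ j xs ⟩
    map (punchIn j) (keepRightmost (delete j xs)) ++ j ∷ []
      ≡⟨ cong (λ ys → map (punchIn j) ys ++ j ∷ []) (keepRightmost-∈ y∈) ⟨
    map (punchIn j) (keepRightmost (y ∷ delete j xs)) ++ j ∷ [] ∎
  byCases (no y∉) = begin
    keepRightmost (punchIn j y ∷ xs ++ j ∷ [])
      ≡⟨ keepRightmost-∉ (λ y∈ → [ y∉ ∘ ∈-delete⁺ , (λ { (here eq) → punchInᵢ≢i j y eq }) ]′ (∈-++⁻ xs y∈)) ⟩
    punchIn j y ∷ keepRightmost (xs ++ j ∷ [])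
      ≡⟨ cong (punchIn j y ∷_) (keepRightmost-∷ʳ j xs) ⟩
    map (punchIn j) (y ∷ keepRightmost (delete j xs)) ++ j ∷ []
      ≡⟨ cong (λ ys → map (punchIn j) ys ++ j ∷ []) (keepRightmost-∉ y∉) ⟨
    map (punchIn j) (keepRightmost (y ∷ delete j xs)) ++ j ∷ [] ∎

-- This is `oneLine` on lists.
completion : List (Fin n) → List (Fin n)
completion {n} a = keepRightmost (allFin n ++ a)

completion-complete : ∀ (a : List (Fin n)) x → x ∈ completion a
completion-complete {n} a x = keepRightmost-∈⁺ (allFin n ++ a) (∈-++⁺ˡ (∈-allFin x))

completion-∷ʳ : ∀ (a : List (Fin (suc n))) j →
  completion (a ++ j ∷ []) ≡ map (punchIn j) (completion (delete j a)) ++ j ∷ []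
completion-∷ʳ {n} a j = begin
  keepRightmost (allFin (suc n) ++ a ++ j ∷ [])
    ≡⟨ cong keepRightmost (++-assoc (allFin (suc n)) a (j ∷ [])) ⟨
  keepRightmost ((allFin (suc n) ++ a) ++ j ∷ [])
    ≡⟨ keepRightmost-∷ʳ j (allFin (suc n) ++ a) ⟩
  map (punchIn j) (keepRightmost (delete j (allFin (suc n) ++ a))) ++ j ∷ []
    ≡⟨ cong (λ xs → map (punchIn j) (keepRightmost xs) ++ j ∷ [])
         (trans (delete-++ j (allFin (suc n)) a) (cong (_++ delete j a) (delete-allFin j))) ⟩
  map (punchIn j) (completion (delete j a)) ++ j ∷ [] ∎

-- Recursion on the size of the alphabet.

majᵂ : List (Fin n) → ℕ
majᵂ a = maj (position (completion a))

majᵂ-[] : majᵂ {n} [] ≡ 0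
majᵂ-[] {n} = trans (maj-cong {n} λ x → begin
  position (completion []) x
    ≡⟨ cong (λ xs → position xs x) (trans (cong keepRightmost (++-identityʳ (allFin n)))
                                          (keepRightmost-unique-id (Unique.allFin⁺ n))) ⟩
  position (allFin n) x
    ≡⟨ position-tabulate id id x ⟩
  toℕ x ∎) (maj-toℕ n)

∑-majᵂ-insert : ∀ (a : List (Fin n)) (h : ℕ → ℤ) →
  ∑[ j < suc n ] h (maj (position (map (punchIn j) (completion a) ++ j ∷ []))) ≡ window (suc n) h (majᵂ a)
∑-majᵂ-insert a = ∑-maj-insert {τ = λ j → position (map (punchIn j) (completion a) ++ j ∷ [])} record
  { bound = λ x → position<length (completion-complete a x)
  ; old   = λ j x → position-map-punchIn j (completion-complete a x)
  ; new   = λ j → position-hole j (completion a)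
  }

∑ᵂ-majᵂ-suc : ∀ r (h : ℕ → ℤ) →
  ∑ᵂ {n = suc n} (suc r) (h ∘ majᵂ) ≡ binomialSum (λ k → ∑ᵂ {n = n} k (window (suc n) h ∘ majᵂ)) r
∑ᵂ-majᵂ-suc {n} r h = begin
  ∑ᵂ (suc r) (h ∘ majᵂ {suc n})
    ≡⟨ ∑ᵂ-init-last r (h ∘ majᵂ) ⟩
  ∑[ j < suc n ] ∑ᵂ r (λ a → h (majᵂ (a ++ j ∷ [])))
    ≡⟨ sum-cong-≗ {suc n} (λ j → ∑ᵂ-cong r (λ a → cong (h ∘ maj ∘ position) (completion-∷ʳ a j))) ⟩
  ∑[ j < suc n ] ∑ᵂ r (g j ∘ delete j)
    ≡⟨ sum-cong-≗ {suc n} (λ j → ∑ᵂ-delete j r (g j)) ⟩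
  ∑[ j < suc n ] binomialSum (λ k → ∑ᵂ k (g j)) r
    ≡⟨ sum-binomialSum (λ j k → ∑ᵂ k (g j)) r ⟩
  binomialSum (λ k → ∑[ j < suc n ] ∑ᵂ k (g j)) r
    -- After the deletion the words no longer depend on `j`, so the sum over `j` can be taken for a
    -- fixed word, where it is a sum over all insertions.
    ≡⟨ binomialSum-cong (λ k → trans (∑ᵂ-∑ k g) (∑ᵂ-cong k (λ a → ∑-majᵂ-insert a h))) r ⟩
  binomialSum (λ k → ∑ᵂ k (window (suc n) h ∘ majᵂ)) r ∎
  where
  g : Fin (suc n) → List (Fin n) → ℤ
  g j a = h (maj (position (map (punchIn j) (completion a) ++ j ∷ [])))

-- Word length 0 and the term `ℓ = 0` are included because the binomial sum in the recursion reaches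
-- the empty word. The induction on `n` is for all `h`, since each step replaces `h` by a `window`
-- of it.
∑ᵂ-majᵂ : ∀ n r (h : ℕ → ℤ) →
  ∑ᵂ {n = n} r (h ∘ majᵂ) ≡ ∑[ ℓ < suc n ] (stirling (toℕ ℓ) r * eval h (fallingₚ n (toℕ ℓ)))
∑ᵂ-majᵂ n       zero    h = begin
  h (majᵂ {n} [])
    ≡⟨ cong h (majᵂ-[] {n}) ⟩
  h 0
    ≡⟨ trans (*-identityˡ _) (eval-q^ h 0) ⟨
  1ℤ * eval h (fallingₚ n 0)
    ≡⟨ +-identityʳ _ ⟨
  1ℤ * eval h (fallingₚ n 0) + 0ℤ
    ≡⟨ cong (1ℤ * eval h (fallingₚ n 0) +_) (trans (sum-cong-≗ {n} {λ ℓ → stirling (suc (toℕ ℓ)) 0 * eval h (fallingₚ n (suc (toℕ ℓ)))} (λ ℓ → *-zeroˡ (eval h (fallingₚ n (suc (toℕ ℓ))))))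
                          (sum-replicate-zero n)) ⟨
  ∑[ ℓ < suc n ] (stirling (toℕ ℓ) 0 * eval h (fallingₚ n (toℕ ℓ))) ∎
∑ᵂ-majᵂ zero    (suc r) h = refl
∑ᵂ-majᵂ (suc n) (suc r) h = begin
  ∑ᵂ (suc r) (h ∘ majᵂ)
    ≡⟨ ∑ᵂ-majᵂ-suc r h ⟩
  binomialSum (λ k → ∑ᵂ k (h′ ∘ majᵂ)) r
    ≡⟨ binomialSum-cong (λ k → ∑ᵂ-majᵂ n k h′) r ⟩
  binomialSum (λ k → ∑[ ℓ < suc n ] (stirling (toℕ ℓ) k * eval h′ (fallingₚ n (toℕ ℓ)))) r
    ≡⟨ sum-binomialSum {suc n} (λ ℓ k → stirling (toℕ ℓ) k * eval h′ (fallingₚ n (toℕ ℓ))) r ⟨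
  ∑[ ℓ < suc n ] binomialSum (λ k → stirling (toℕ ℓ) k * eval h′ (fallingₚ n (toℕ ℓ))) r
    ≡⟨ sum-cong-≗ {suc n} (λ ℓ → trans
         (cong (stirling (suc (toℕ ℓ)) (suc r) *_) (eval-fallingₚ-suc h n (toℕ ℓ)))
         (binomialSum-*ʳ (stirling (toℕ ℓ)) (eval h′ (fallingₚ n (toℕ ℓ))) r)) ⟨
  ∑[ ℓ < suc n ] (stirling (suc (toℕ ℓ)) (suc r) * eval h (fallingₚ (suc n) (suc (toℕ ℓ))))
    -- The term `ℓ = 0` can be added, since `stirling 0 (suc r)` is zero.
    ≡⟨ +-identityˡ _ ⟨
  ∑[ ℓ < 2 ℕ.+ n ] (stirling (toℕ ℓ) (suc r) * eval h (fallingₚ (suc n) (toℕ ℓ))) ∎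
  where
  h′ : ℕ → ℤ
  h′ = window (suc n) h

proposition2p3 : ∀ (r n : ℕ) .{{_ : NonZero r}} .{{_ : NonZero n}} →
    ∑ₚ (map (λ a → q^ imaj (w a)) (words n r))
    ≈ₚ ∑ₚ (map (λ ℓ → natₚ (S r ℓ) *ₚ fallingₚ n ℓ) (map suc (upTo n)))
proposition2p3 (suc r) n = eval⇒≈ₚ {lhs} {rhs} λ h → begin
  eval h lhs
    ≡⟨ eval-∑ₚ h (λ a → q^ imaj (w a)) (words n (suc r)) ⟩
  ∑ᴸ (λ a → eval h (q^ imaj (w a))) (words n (suc r))
    ≡⟨ ∑ᴸ-cong (λ a → trans (eval-q^ h (imaj (w a))) (cong h (imaj-w a))) (words n (suc r)) ⟩
  ∑ᴸ (h ∘ majᵂ {n} ∘ Vec.toList) (words n (suc r))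
    ≡⟨ ∑ᴸ-words (suc r) (h ∘ majᵂ {n}) ⟩
  ∑ᵂ (suc r) (h ∘ majᵂ {n})
    ≡⟨ ∑ᵂ-majᵂ n (suc r) h ⟩
  0ℤ * eval h (fallingₚ n 0) + ∑[ ℓ < n ] (stirling (suc (toℕ ℓ)) (suc r) * eval h (fallingₚ n (suc (toℕ ℓ))))
    -- Here the word length is positive, so the term `ℓ = 0` vanishes and the sum starts at 1.
    ≡⟨ trans (cong (_+ ∑[ ℓ < n ] (stirling (suc (toℕ ℓ)) (suc r) * eval h (fallingₚ n (suc (toℕ ℓ))))) (*-zeroˡ (eval h (fallingₚ n 0)))) (+-identityˡ _) ⟩
  ∑[ ℓ < n ] (stirling (suc (toℕ ℓ)) (suc r) * eval h (fallingₚ n (suc (toℕ ℓ))))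
    ≡⟨ ∑ᴸ-applyUpTo (λ ℓ → stirling (suc ℓ) (suc r) * eval h (fallingₚ n (suc ℓ))) id n ⟨
  ∑ᴸ (λ ℓ → stirling (suc ℓ) (suc r) * eval h (fallingₚ n (suc ℓ))) (upTo n)
    ≡⟨ ∑ᴸ-map (λ ℓ → stirling ℓ (suc r) * eval h (fallingₚ n ℓ)) suc (upTo n) ⟨
  ∑ᴸ (λ ℓ → stirling ℓ (suc r) * eval h (fallingₚ n ℓ)) (map suc (upTo n))
    ≡⟨ ∑ᴸ-cong (λ ℓ → trans (eval-natₚ-*ₚ h (S (suc r) ℓ) (fallingₚ n ℓ))
                            (cong (_* eval h (fallingₚ n ℓ)) (S≡stirling (suc r) ℓ))) (map suc (upTo n)) ⟨
  ∑ᴸ (λ ℓ → eval h (natₚ (S (suc r) ℓ) *ₚ fallingₚ n ℓ)) (map suc (upTo n))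
    ≡⟨ eval-∑ₚ h (λ ℓ → natₚ (S (suc r) ℓ) *ₚ fallingₚ n ℓ) (map suc (upTo n)) ⟨
  eval h rhs ∎
  where
  lhs rhs : Poly
  lhs = ∑ₚ (map (λ a → q^ imaj (w a)) (words n (suc r)))
  rhs = ∑ₚ (map (λ ℓ → natₚ (S (suc r) ℓ) *ₚ fallingₚ n ℓ) (map suc (upTo n)))
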